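{- Let $G$ be a finite simple graph, let $G_1,G_2$ be subgraphs with $V(G)=V(G_1)\cup V(G_2)$ and $E(G)=E(G_1)\cup E(G_2)$, and let $H$ be the graph with $V(H)=V(G_1)\cap V(G_2)$, $E(H)=E(G_1)\cap E(G_2)$. Let $t$ be a rational number. If $\chi_f(G_1)\le t$ and every extremal fractional coloring in $\mathcal{F}_t(H)$ is extensible in $\mathcal{F}_t(G_2)$, then $\chi_f(G)\le t$.
   Context: A $b$-fold coloring $\mathbf{c}$ of a graph assigns to each vertex a set of $b$ colors so that adjacent vertices receive disjoint sets; $A(\mathbf{c})$ is the set of colors used. Two $b$-fold colorings are isomorphic if they differ by a bijective renaming of colors. $\mathbf{c}_1+\mathbf{c}_2$ assigns each vertex the disjoint union of its color sets, and $t\cdot\mathbf{c}$ is the sum of $t$ copies. For $\mathbf{c}_1$ $b_1$-fold and $\mathbf{c}_2$ $b_2$-fold, $\mathbf{c}_1\sim\mathbf{c}_2$ if $sb_2\cdot\mathbf{c}_1$ and $sb_1\cdot\mathbf{c}_2$ are isomorphic for some positive integer $s$. $\mathcal{F}(G)$ is the set of $\sim$-classes of multifold colorings of $G$ (fractional colorings); the class of a $b$-fold $\mathbf{c}$ is $\frac{\mathbf{c}}{b}$. For rational $\lambda=q/p\in[0,1]$, $\lambda\frac{\mathbf{c}_1}{b_1}+(1-\lambda)\frac{\mathbf{c}_2}{b_2}=\frac{qb_2\cdot\mathbf{c}_1+(p-q)b_1\cdot\mathbf{c}_2}{pb_1b_2}$. Let $g_G(\frac{\mathbf{c}}{b})=|A(\mathbf{c})|/b$,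 $\mathcal{F}_t(G)=\{f\in\mathcal{F}(G):g_G(f)\le t\}$; a member of $\mathcal{F}_t(G)$ is extremal if it cannot be written as a linear combination of two or more distinct members of $\mathcal{F}_t(G)$. The fractional chromatic number is $\chi_f(G)=\min\{g_G(f):f\in\mathcal{F}(G)\}$. For a subgraph $H$ of $G$, restriction induces $i_G^H\colon\mathcal{F}(G)\to\mathcal{F}(H)$, and $f\in\mathcal{F}(H)$ is extensible in $\mathcal{F}_t(G)$ if $f=i_G^H(f')$ for some $f'\in\mathcal{F}_t(G)$. -}

module Defs where

open import Data.Bool using (Bool; true; false; _∧_; _∨_; if_then_else_)
open import Data.Bool.Properties using (∧-comm)
open import Data.Nat using (ℕ; zero; suc; _+_; _*_; NonZero)
open import Data.Nat.Properties using (_≟_)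
open import Data.Fin using (Fin)
open import Data.List using (List; []; _∷_; _++_; map; length; concatMap; allFin; deduplicate; replicate)
open import Data.Nat.ListAction using (sum)
open import Data.List.Membership.Propositional using (_∈_)
open import Data.List.Relation.Unary.Unique.Propositional using (Unique)
open import Data.List.Relation.Unary.All using (All)
open import Data.List.Relation.Unary.AllPairs using (AllPairs)
open import Data.List.Relation.Binary.Permutation.Propositional using (_↭_)
open import Data.Integer using (+_)
open import Data.Rational using (ℚ; _/_; _≤_)
open import Data.Product using (Σ; _×_; _,_; ∃; proj₁; proj₂)
open import Data.Empty using (⊥)
open import Relation.Nullary using (¬_)
open import Relation.Binary.PropositionalEquality using (_≡_; refl; cong₂; sym; trans)

-- Finite simple graphs, all living inside the ambient vertex universe Fin n.
-- A graph is given by its vertex set V ⊆ Fin n and its edge relation E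
-- (symmetric, irreflexive, and only between vertices of V).

record Graph (n : ℕ) : Set where
  field
    V      : Fin n → Bool
    E      : Fin n → Fin n → Bool
    E-sym  : ∀ x y → E x y ≡ E y x
    E-irr  : ∀ x → E x x ≡ false
    E-V    : ∀ x y → E x y ≡ true → V x ≡ true

open Graph public

_⊆G_ : ∀ {n} → Graph n → Graph n → Set
H ⊆G G = (∀ x → V H x ≡ true → V G x ≡ true)
       × (∀ x y → E H x y ≡ true → E G x y ≡ true)

private
  ∧-true-l : ∀ a b → a ∧ b ≡ true → a ≡ true
  ∧-true-l true  b p = refl
  ∧-true-l false b ()

  ∧-true-r : ∀ a b → a ∧ b ≡ true → b ≡ true
  ∧-true-r true  b p = p
  ∧-true-r false b ()

  false-∧ : ∀ a b → a ≡ false → a ∧ b ≡ false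
  false-∧ .false b refl = refl

_∩G_ : ∀ {n} → Graph n → Graph n → Graph n
G₁ ∩G G₂ = record
  { V     = λ x → V G₁ x ∧ V G₂ x
  ; E     = λ x y → E G₁ x y ∧ E G₂ x y
  ; E-sym = λ x y → cong₂ _∧_ (E-sym G₁ x y) (E-sym G₂ x y)
  ; E-irr = λ x → false-∧ (E G₁ x x) (E G₂ x x) (E-irr G₁ x)
  ; E-V   = λ x y p → cong₂ _∧_ (E-V G₁ x y (∧-true-l _ _ p))
                                (E-V G₂ x y (∧-true-r (E G₁ x y) _ p))
  }

-- Multifold colorings.  Colors are natural numbers; a (raw) color
-- assignment gives each vertex of the universe a list of colors
-- (a finite set: the lists are required to be duplicate-free).

RawCol : ℕ → Set
RawCol n = Fin n → List ℕ

Disjoint : List ℕ → List ℕ → Set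
Disjoint xs ys = ∀ x → x ∈ xs → x ∈ ys → ⊥

record IsColoring {n} (G : Graph n) (b : ℕ) (c : RawCol n) : Set where
  field
    uniq  : ∀ v → Unique (c v)
    size  : ∀ v → V G v ≡ true → length (c v) ≡ b
    outside : ∀ v → V G v ≡ false → c v ≡ []
    disj  : ∀ u v → E G u v ≡ true → Disjoint (c u) (c v)

record MColoring {n} (G : Graph n) : Set where
  constructor mcol
  field
    fold  : ℕ
    {{fold≢0}} : NonZero fold
    col   : RawCol n
    valid : IsColoring G fold col

open MColoring public

usedColors : ∀ {n} → RawCol n → List ℕ
usedColors {n} c = concatMap c (allFin n)

numColors : ∀ {n} → RawCol n → ℕ
numColors c = length (deduplicate _≟_ (usedColors c))

-- isomorphism: the colorings differ by a bijective renaming A(c₁) → A(c₂)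
-- (a renaming f injective on A(c₁) with c₂(v) = f(c₁(v)) for all v;
-- surjectivity onto A(c₂) follows)
Iso : ∀ {n} → RawCol n → RawCol n → Set
Iso c₁ c₂ = Σ (ℕ → ℕ) λ f →
    (∀ x y → x ∈ usedColors c₁ → y ∈ usedColors c₁ → f x ≡ f y → x ≡ y)
  × (∀ v → c₂ v ↭ map f (c₁ v))

-- disjoint union of a list of colorings c₀,…,c_{k-1}: color x of cᵢ is
-- renamed to k·x + i, so that the color sets are disjoint.
private
  dunionFrom : ∀ {n} → ℕ → ℕ → List (RawCol n) → RawCol n
  dunionFrom k i []       v = []
  dunionFrom k i (c ∷ cs) v = map (λ x → k * x + i) (c v) ++ dunionFrom k (suc i) cs v

dunion : ∀ {n} → List (RawCol n) → RawCol n
dunion cs = dunionFrom (length cs) 0 cs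

_⊕_ : ∀ {n} → RawCol n → RawCol n → RawCol n
c₁ ⊕ c₂ = dunion (c₁ ∷ c₂ ∷ [])

_·_ : ∀ {n} → ℕ → RawCol n → RawCol n
t · c = dunion (replicate t c)

Equiv : ∀ {n} → (ℕ × RawCol n) → (ℕ × RawCol n) → Set
Equiv (b₁ , c₁) (b₂ , c₂) = Σ ℕ λ s → NonZero s × Iso ((s * b₂) · c₁) ((s * b₁) · c₂)

frac : ∀ {n} {G : Graph n} → MColoring G → ℕ × RawCol n
frac c = fold c , col c

gval : ∀ {n} {G : Graph n} → MColoring G → ℚ
gval c = (+ numColors (col c)) / fold c

InFt : ∀ {n} {G : Graph n} → ℚ → MColoring G → Set
InFt t c = gval c ≤ t

-- Linear (convex) combinations with positive rational weights.
-- A combination λ₁ f₁ + … + λ_k f_k with λᵢ > 0 rational, Σ λᵢ = 1, of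
-- fᵢ = cᵢ/bᵢ is, unfolding the paper's definition, the class of
-- Σ mᵢ·cᵢ  (a (Σ mᵢ bᵢ)-fold coloring) with positive integers mᵢ
-- (λᵢ = mᵢ bᵢ / Σ mⱼ bⱼ).

WeightedCol : ∀ {n} → Graph n → Set
WeightedCol G = ℕ × MColoring G

combFold : ∀ {n} {G : Graph n} → List (WeightedCol G) → ℕ
combFold ws = sum (map (λ w → proj₁ w * fold (proj₂ w)) ws)

combCol : ∀ {n} {G : Graph n} → List (WeightedCol G) → RawCol _
combCol ws = dunion (map (λ w → proj₁ w · col (proj₂ w)) ws)

IsCombination : ∀ {n} (G : Graph n) → ℚ → MColoring G → Set
IsCombination G t f = Σ (List (WeightedCol G)) λ ws →
    (2 Data.Nat.≤ length ws)
  × All (λ w → NonZero (proj₁ w) × InFt t (proj₂ w)) ws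
  × AllPairs (λ w w′ → ¬ Equiv (frac (proj₂ w)) (frac (proj₂ w′))) ws
  × Equiv (frac f) (combFold ws , combCol ws)

Extremal : ∀ {n} (G : Graph n) → ℚ → MColoring G → Set
Extremal G t f = InFt t f × ¬ IsCombination G t f

restrict : ∀ {n} → Graph n → RawCol n → RawCol n
restrict H c v = if V H v then c v else []

Extensible : ∀ {n} (H G : Graph n) → ℚ → MColoring H → Set
Extensible H G t f = Σ (MColoring G) λ f′ →
    InFt t f′ × Equiv (fold f′ , restrict H (col f′)) (frac f)

-- χ_f(G) ≤ t  (χ_f is the attained minimum of g_G over F(G))
χf≤ : ∀ {n} → Graph n → ℚ → Set
χf≤ G t = Σ (MColoring G) λ f → InFt t f

{-# OPTIONS --safe #-}
module Submission where

-- A b-fold colouring is determined up to isomorphism by the multiset of its colour classes. After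
-- scaling so that t·b is an integer, add unused colours (empty classes) until there are exactly t·b
-- colours: fractional colourings in F_t(H) become the rational points of a polytope
-- {x ≥ 0 : M x = β}. Such a point is a vertex iff the columns of M in its support are independent,
-- which Gaussian elimination decides; otherwise a kernel vector d moves the point in the directions
-- d and − d until its support shrinks, and the point is a convex combination of the two ends.
-- Hence every colouring in F_t(H) is a combination of extremal ones, and combining their extensions
-- extends it to G₂. Applied to the restriction of a colouring of G₁, this yields colourings of G₁
-- and G₂ with equally many colours and the same restricted classes; match the colours and unite
-- the two classes of each matched pair.

open import Defs
open import Data.Bool using (Bool; true; false; _∧_; _∨_; if_then_else_)
import Data.Bool as Bool
import Data.Bool.Properties as Boolₚ
open import Data.Empty using (⊥)
open import Data.Fin using (Fin; zero; suc)
import Data.Fin.Properties as Finₚ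
open import Data.Integer using (ℤ; +_; -_; _+_; _*_; _-_; _≤_; _<_; 0ℤ; 1ℤ; +≤+; +<+; ∣_∣)
import Data.Integer as ℤ
import Data.Integer.Properties as ℤₚ
open import Data.Integer.Properties using (pos-*)
open import Data.Integer.Tactic.RingSolver using (solve-∀)
open import Data.List
  using (List; []; _∷_; _++_; map; length; concat; concatMap; filter; replicate; tabulate; deduplicate; allFin)
open import Data.List.Membership.Propositional using (_∈_; _∉_; find; lose)
open import Data.List.Membership.Propositional.Properties
  using (∈-length; ∈-filter⁺; ∈-filter⁻; ∈-concatMap⁺; ∈-concatMap⁻; ∈-deduplicate⁺; ∈-deduplicate⁻;
         ∈-map⁺; ∈-map⁻; ∈-++⁺ˡ; ∈-++⁺ʳ; ∈-++⁻; ∈-∃++; ∈-allFin)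
open import Data.List.Membership.Propositional.Properties.WithK using (unique∧set⇒bag)
open import Data.List.Properties
  using (filter-notAll; length-filter; map-∘; map-id; map-cong-local; map-++; length-map; ∷-injective)
open import Data.List.Relation.Binary.BagAndSetEquality using (∼bag⇒↭)
open import Data.List.Relation.Binary.Permutation.Propositional as Perm
  using (_↭_; ↭-refl; ↭-sym; ↭-trans; prep; ↭⇒↭ₛ)
open import Data.List.Relation.Binary.Permutation.Propositional.Properties using (shift; ∈-resp-↭; ↭-map-inv)
import Data.List.Relation.Binary.Permutation.Setoid.Properties as Permₛ
open import Data.List.Relation.Binary.Pointwise using (Pointwise; []; _∷_)
open import Data.List.Relation.Unary.All as All using (All; []; _∷_)
import Data.List.Relation.Unary.All.Properties as Allₚ
open import Data.List.Relation.Unary.AllPairs using ([]; _∷_)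
import Data.List.Relation.Unary.AllPairs.Properties as AllPairsₚ
open import Data.List.Relation.Unary.Any as Any using (here; there)
open import Data.List.Relation.Unary.Unique.Propositional using (Unique)
import Data.List.Relation.Unary.Unique.DecPropositional.Properties as UniqueDec
open import Data.List.Relation.Unary.Unique.Propositional.Properties using ()
  renaming (filter⁺ to Unique-filter⁺; map⁺ to Unique-map⁺; ++⁺ to Unique-++⁺)
open import Data.Nat using (ℕ; zero; suc; NonZero)
import Data.Nat as ℕ
import Data.Nat.DivMod as ℕ
import Data.Nat.Properties as ℕₚ
open import Data.Nat.Tactic.RingSolver using () renaming (solve-∀ to ℕ-solve-∀)
open import Data.Product using (∃; ∃₂; _×_; _,_; proj₁; proj₂)
open import Data.Rational using (ℚ; ↥_; ↧_; ↧ₙ_)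
import Data.Rational as ℚ
import Data.Rational.Properties as ℚₚ
open import Data.Rational.Unnormalised using (mkℚᵘ; *≤*)
import Data.Rational.Unnormalised.Properties as ℚᵘₚ
open import Data.Sum using (_⊎_; inj₁; inj₂; [_,_]′)
open import Data.Vec using (Vec; lookup)
import Data.Vec as Vec
import Data.Vec.Properties as Vecₚ
open import Function using (_∘_; id; mk⇔)
open import Relation.Binary using (DecidableEquality)
open import Relation.Binary.PropositionalEquality
open import Relation.Nullary using (¬_; Dec; yes; no; contradiction; ¬?)
open import Relation.Nullary.Decidable using (does; dec-true; dec-false; decidable-stable)
import Algebra.Properties.AbelianGroup ℤₚ.+-0-abelianGroup as ℤ-group

-- Renamings of colours are awkward to compose, so a list `L` of classes is handled through the
-- functional sending `φ` to `∑ L φ`. Copies, unions and convex combinations become linear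
-- identities between sums. No rational coordinates occur: a point carries its fold as a
-- denominator, and proportionality reads `i * ∑ L φ ≡ j * ∑ L′ φ`. The empty classes do two jobs.
-- They are the slack that turns the bound by t into an equation, and they keep track of colours
-- that vanish on restriction to H: such a colour of G₁ must still be paired with one of G₂. Their
-- number, which an isomorphism cannot see, is recovered from the equation for the total size.
-- Rigidity is phrased as proportionality of feasible points, the form that contradicts the
-- distinctness of the members of a combination.

private variable
  A B : Set
  n   : ℕ

-- Integer sums over lists

∑ : List A → (A → ℤ) → ℤ
∑ []       φ = 0ℤ
∑ (x ∷ xs) φ = φ x + ∑ xs φ

∑-cong : ∀ (xs : List A) {φ ψ : A → ℤ} → (∀ {x} → x ∈ xs → φ x ≡ ψ x) → ∑ xs φ ≡ ∑ xs ψ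
∑-cong []       eq = refl
∑-cong (x ∷ xs) eq = cong₂ _+_ (eq (here refl)) (∑-cong xs (eq ∘ there))

∑-++ : ∀ (xs ys : List A) φ → ∑ (xs ++ ys) φ ≡ ∑ xs φ + ∑ ys φ
∑-++ []       ys φ = sym (ℤₚ.+-identityˡ _)
∑-++ (x ∷ xs) ys φ = trans (cong (λ z → φ x + z) (∑-++ xs ys φ)) (sym (ℤₚ.+-assoc (φ x) _ _))

∑-map : ∀ (f : A → B) xs φ → ∑ (map f xs) φ ≡ ∑ xs (φ ∘ f)
∑-map f []       φ = refl
∑-map f (x ∷ xs) φ = cong (λ z → φ (f x) + z) (∑-map f xs φ)

∑-↭ : ∀ {xs ys : List A} → xs ↭ ys → ∀ φ → ∑ xs φ ≡ ∑ ys φ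
∑-↭ Perm.refl          φ = refl
∑-↭ (prep x p)         φ = cong (λ z → φ x + z) (∑-↭ p φ)
∑-↭ (Perm.swap x y p)  φ = trans (cong (λ z → φ x + (φ y + z)) (∑-↭ p φ)) (exchange (φ x) (φ y) _)
  where
  exchange : ∀ a b c → a + (b + c) ≡ b + (a + c)
  exchange = solve-∀
∑-↭ (Perm.trans p q)   φ = trans (∑-↭ p φ) (∑-↭ q φ)

∑-zero : ∀ (xs : List A) → ∑ xs (λ _ → 0ℤ) ≡ 0ℤ
∑-zero []       = refl
∑-zero (x ∷ xs) = trans (ℤₚ.+-identityˡ _) (∑-zero xs)

∑-linear : ∀ (xs : List A) a b φ ψ →
           ∑ xs (λ x → a * φ x + b * ψ x) ≡ a * ∑ xs φ + b * ∑ xs ψ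
∑-linear []       a b φ ψ = nil a b
  where
  nil : ∀ a b → 0ℤ ≡ a * 0ℤ + b * 0ℤ
  nil = solve-∀
∑-linear (x ∷ xs) a b φ ψ =
  trans (cong (λ z → a * φ x + b * ψ x + z) (∑-linear xs a b φ ψ)) (step a b (φ x) (ψ x) _ _)
  where
  step : ∀ a b f g s t → a * f + b * g + (a * s + b * t) ≡ a * (f + s) + b * (g + t)
  step = solve-∀

∑-scale : ∀ (xs : List A) a φ → ∑ xs (λ x → a * φ x) ≡ a * ∑ xs φ
∑-scale xs a φ = begin
  ∑ xs (λ x → a * φ x)               ≡⟨ ∑-cong xs (λ {x} _ → pad a (φ x)) ⟩
  ∑ xs (λ x → a * φ x + 0ℤ * φ x)    ≡⟨ ∑-linear xs a 0ℤ φ φ ⟩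
  a * ∑ xs φ + 0ℤ * ∑ xs φ           ≡⟨ pad a (∑ xs φ) ⟨
  a * ∑ xs φ                         ∎
  where
  open ≡-Reasoning
  pad : ∀ a f → a * f ≡ a * f + 0ℤ * f
  pad = solve-∀

∑-nonneg : ∀ (xs : List A) φ → (∀ {x} → x ∈ xs → 0ℤ ≤ φ x) → 0ℤ ≤ ∑ xs φ
∑-nonneg []       φ nn = ℤₚ.≤-refl
∑-nonneg (x ∷ xs) φ nn = ℤₚ.+-mono-≤ (nn (here refl)) (∑-nonneg xs φ (nn ∘ there))

∑-pos : ∀ (xs : List A) φ → (∀ {x} → x ∈ xs → 0ℤ ≤ φ x) → ∀ {x} → x ∈ xs → 0ℤ < φ x → 0ℤ < ∑ xs φ
∑-pos (x ∷ xs) φ nn (here refl) pos = ℤₚ.+-mono-<-≤ pos (∑-nonneg xs φ (nn ∘ there))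
∑-pos (x ∷ xs) φ nn (there i)   pos = ℤₚ.+-mono-≤-< (nn (here refl)) (∑-pos xs φ (nn ∘ there) i pos)

copies : ℕ → List A → List A
copies k xs = concat (replicate k xs)

∑-copies : ∀ k (xs : List A) φ → ∑ (copies k xs) φ ≡ + k * ∑ xs φ
∑-copies zero    xs φ = sym (ℤₚ.*-zeroˡ (∑ xs φ))
∑-copies (suc k) xs φ = trans (∑-++ xs (copies k xs) φ)
  (trans (cong (λ z → ∑ xs φ + z) (∑-copies k xs φ)) (sym (ℤₚ.suc-* (+ k) (∑ xs φ))))

∑-replicate : ∀ k (x : A) φ → ∑ (replicate k x) φ ≡ + k * φ x
∑-replicate zero    x φ = sym (ℤₚ.*-zeroˡ (φ x))
∑-replicate (suc k) x φ = trans (cong (λ z → φ x + z) (∑-replicate k x φ)) (sym (ℤₚ.suc-* (+ k) (φ x)))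

∑-concatMap : ∀ (f : A → List B) xs φ → ∑ (concatMap f xs) φ ≡ ∑ xs (λ x → ∑ (f x) φ)
∑-concatMap f []       φ = refl
∑-concatMap f (x ∷ xs) φ = trans (∑-++ (f x) _ φ) (cong (λ z → ∑ (f x) φ + z) (∑-concatMap f xs φ))

∑-const : ∀ (xs : List A) a → ∑ xs (λ _ → a) ≡ + length xs * a
∑-const []       a = sym (ℤₚ.*-zeroˡ a)
∑-const (x ∷ xs) a = trans (cong (λ z → a + z) (∑-const xs a)) (sym (ℤₚ.suc-* (+ length xs) a))

bit : Bool → ℤ
bit true  = 1ℤ
bit false = 0ℤ

bit-nonneg : ∀ b → 0ℤ ≤ bit b
bit-nonneg true  = +≤+ ℕ.z≤n
bit-nonneg false = +≤+ ℕ.z≤n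

-- Lists as multisets

module Multiplicity {A : Set} (_≟_ : DecidableEquality A) where

  ind : A → A → ℤ
  ind a b = bit (does (a ≟ b))

  ind-refl : ∀ a → ind a a ≡ 1ℤ
  ind-refl a = cong bit (dec-true (a ≟ a) refl)

  ind-≢ : ∀ {a b} → a ≢ b → ind a b ≡ 0ℤ
  ind-≢ {a} {b} ne = cong bit (dec-false (a ≟ b) ne)

  mult : List A → A → ℤ
  mult xs a = ∑ xs (ind a)

  mult-nonneg : ∀ xs a → 0ℤ ≤ mult xs a
  mult-nonneg xs a = ∑-nonneg xs (ind a) (λ _ → bit-nonneg _)

  mult-pos : ∀ {xs a} → a ∈ xs → 0ℤ < mult xs a
  mult-pos {xs} {a} i = ∑-pos xs (ind a) (λ _ → bit-nonneg _) i (subst (0ℤ <_) (sym (ind-refl a)) (+<+ ℕ.z<s))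

  mult-∉ : ∀ {xs a} → a ∉ xs → mult xs a ≡ 0ℤ
  mult-∉ {xs} {a} a∉ = trans (∑-cong xs (λ i → ind-≢ (λ { refl → a∉ i }))) (∑-zero xs)

  open import Data.List.Membership.DecPropositional _≟_ using (_∈?_) public

  mult≢0⇒∈ : ∀ {xs a} → mult xs a ≢ 0ℤ → a ∈ xs
  mult≢0⇒∈ {xs} {a} ne with a ∈? xs
  ... | yes i = i
  ... | no a∉ = contradiction (mult-∉ a∉) ne

  ∑-ind : ∀ {xs} → Unique xs → ∀ {a} → a ∈ xs → ∀ (φ : A → ℤ) → ∑ xs (λ x → ind x a * φ x) ≡ φ a
  ∑-ind {x ∷ xs} (x∉ ∷ u) (here refl) φ = trans (cong₂ _+_
      (trans (cong (_* φ x) (ind-refl x)) (ℤₚ.*-identityˡ (φ x)))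
      (trans (∑-cong xs (λ {y} i → trans (cong (_* φ y) (ind-≢ (λ { refl → All.lookup x∉ i refl }))) (ℤₚ.*-zeroˡ (φ y)))) (∑-zero xs)))
    (ℤₚ.+-identityʳ (φ x))
  ∑-ind {x ∷ xs} (x∉ ∷ u) {a} (there i) φ = trans (cong₂ _+_
      (trans (cong (_* φ x) (ind-≢ (λ { refl → All.lookup x∉ i refl }))) (ℤₚ.*-zeroˡ (φ x)))
      (∑-ind u i φ))
    (ℤₚ.+-identityˡ (φ a))

  ∑-by-mult : ∀ {T} → Unique T → ∀ xs → (∀ {x} → x ∈ xs → x ∈ T) → ∀ (φ : A → ℤ) →
              ∑ xs φ ≡ ∑ T (λ a → mult xs a * φ a)
  ∑-by-mult {T} u []       sub φ = sym (trans (∑-cong T (λ {a} _ → ℤₚ.*-zeroˡ (φ a))) (∑-zero T))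
  ∑-by-mult {T} u (x ∷ xs) sub φ = begin
    φ x + ∑ xs φ
      ≡⟨ cong₂ _+_ (sym (∑-ind u (sub (here refl)) φ)) (∑-by-mult u xs (sub ∘ there) φ) ⟩
    ∑ T (λ a → ind a x * φ a) + ∑ T (λ a → mult xs a * φ a)
      ≡⟨ one (∑ T (λ a → ind a x * φ a)) (∑ T (λ a → mult xs a * φ a)) ⟩
    1ℤ * ∑ T (λ a → ind a x * φ a) + 1ℤ * ∑ T (λ a → mult xs a * φ a)
      ≡⟨ ∑-linear T 1ℤ 1ℤ _ _ ⟨
    ∑ T (λ a → 1ℤ * (ind a x * φ a) + 1ℤ * (mult xs a * φ a))
      ≡⟨ ∑-cong T (λ {a} _ → distrib (ind a x) (mult xs a) (φ a)) ⟩
    ∑ T (λ a → mult (x ∷ xs) a * φ a) ∎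
    where
    open ≡-Reasoning
    one : ∀ s t → s + t ≡ 1ℤ * s + 1ℤ * t
    one = solve-∀
    distrib : ∀ a b c → 1ℤ * (a * c) + 1ℤ * (b * c) ≡ (a + b) * c
    distrib = solve-∀

  mult-≡⇒↭ : ∀ {xs ys} → (∀ a → mult xs a ≡ mult ys a) → xs ↭ ys
  mult-≡⇒↭ {[]}     {[]}     eq = ↭-refl
  mult-≡⇒↭ {[]}     {y ∷ ys} eq = contradiction (eq y) (ℤₚ.<⇒≢ (mult-pos {y ∷ ys} (here refl)))
  mult-≡⇒↭ {x ∷ xs} {ys}     eq
    with ∈-∃++ (mult≢0⇒∈ {ys} {x} (λ z → ℤₚ.<⇒≢ (mult-pos {x ∷ xs} (here refl)) (sym (trans (eq x) z))))
  ... | ys₁ , ys₂ , refl = ↭-trans (prep x (mult-≡⇒↭ {xs} {ys₁ ++ ys₂} (λ a → ℤ-group.∙-cancelˡ (ind a x) _ _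
          (trans (eq a) (∑-↭ (shift x ys₁ ys₂) (ind a)))))) (↭-sym (shift x ys₁ ys₂))

  -- Indicator functions read off multiplicities, so the family of all sums is a complete invariant
  -- of the multiset.
  ∑-≡⇒↭ : ∀ {xs ys} → (∀ φ → ∑ xs φ ≡ ∑ ys φ) → xs ↭ ys
  ∑-≡⇒↭ eq = mult-≡⇒↭ (λ a → eq (ind a))

0≤+ : ∀ {i j} → 0ℤ ≤ i → 0ℤ ≤ j → 0ℤ ≤ i + j
0≤+ = ℤₚ.+-mono-≤

0≤* : ∀ {i j} → 0ℤ ≤ i → 0ℤ ≤ j → 0ℤ ≤ i * j
0≤* {i} {j} (+≤+ {n = m} _) (+≤+ {n = n} _) = subst (0ℤ ≤_) (ℤₚ.pos-* m n) (+≤+ ℕ.z≤n)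

0<* : ∀ {i j} → 0ℤ < i → 0ℤ < j → 0ℤ < i * j
0<* {+ suc m} {+ suc n} _ _ = +<+ ℕ.z<s
0<* {+ suc m} {+ 0}     _ (+<+ ())
0<* {+ 0}               (+<+ ())

0<neg : ∀ {i} → i < 0ℤ → 0ℤ < - i
0<neg = ℤₚ.neg-mono-<

0≤neg : ∀ {i} → i < 0ℤ → 0ℤ ≤ - i
0≤neg = ℤₚ.<⇒≤ ∘ 0<neg

*-cancel-0≤ : ∀ i {j} → 0ℤ < i → 0ℤ ≤ i * j → 0ℤ ≤ j
*-cancel-0≤ (+ suc m) {j} _ p =
  ℤₚ.*-cancelˡ-≤-pos 0ℤ j (+ suc m) (subst (_≤ + suc m * j) (sym (ℤₚ.*-zeroʳ (+ suc m))) p)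
*-cancel-0≤ (+ 0) (+<+ ())

-- Homogeneous linear systems over ℤ

module Elimination {A : Set} (_≟_ : DecidableEquality A) where
  open Multiplicity _≟_

  Kernel : List A → List (A → ℤ) → (A → ℤ) → Set
  Kernel T rows δ = All (λ ρ → ∑ T (λ a → ρ a * δ a) ≡ 0ℤ) rows

  -- Induction on the columns. If column `x` vanishes in every row, the unit vector at `x` lies in
  -- the kernel; otherwise a pivot row `π` eliminates `x`, and both alternatives for `T` carry over
  -- to `x ∷ T`.
  kernel? : ∀ T → Unique T → ∀ rows →
            (∃ λ δ → Kernel T rows δ × ∃ λ a → a ∈ T × δ a ≢ 0ℤ)
          ⊎ (∀ δ → Kernel T rows δ → ∀ {a} → a ∈ T → δ a ≡ 0ℤ)
  kernel? []      u        rows = inj₂ λ _ _ ()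
  kernel? (x ∷ T) (x∉ ∷ u) rows with Any.any? (λ ρ → ¬? (ρ x ℤ.≟ 0ℤ)) rows
  ... | no none = inj₁ ((λ a → ind a x) , All.map (λ {ρ} → unit {ρ}) (Allₚ.¬Any⇒All¬ rows none)
                       , x , here refl , λ e → contradiction (trans (sym (ind-refl x)) e) λ ())
    where
    unit : ∀ {ρ} → ¬ (ρ x ≢ 0ℤ) → ∑ (x ∷ T) (λ a → ρ a * ind a x) ≡ 0ℤ
    unit {ρ} z = begin
      ∑ (x ∷ T) (λ a → ρ a * ind a x)  ≡⟨ ∑-cong (x ∷ T) (λ {a} _ → ℤₚ.*-comm (ρ a) (ind a x)) ⟩
      ∑ (x ∷ T) (λ a → ind a x * ρ a)  ≡⟨ ∑-ind (x∉ ∷ u) (here refl) ρ ⟩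
      ρ x                              ≡⟨ decidable-stable (ρ x ℤ.≟ 0ℤ) z ⟩
      0ℤ                               ∎
      where open ≡-Reasoning
  ... | yes some with find some
  ... | π , π∈ , πx≢0 = reduce (kernel? T u (map elim rows))
    where
    open ≡-Reasoning

    -- Cross-multiplication replaces division: `elim ρ` vanishes at `x`, and `elim π` is the zero
    -- row.
    elim : (A → ℤ) → A → ℤ
    elim ρ a = π x * ρ a + (- ρ x) * π a

    ∑-elim : ∀ ρ δ → ∑ T (λ a → elim ρ a * δ a)
                   ≡ π x * ∑ T (λ a → ρ a * δ a) + (- ρ x) * ∑ T (λ a → π a * δ a)
    ∑-elim ρ δ = trans (∑-cong T (λ {a} _ → expand (π x) (ρ a) (- ρ x) (π a) (δ a)))
                       (∑-linear T (π x) (- ρ x) _ _)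
      where
      expand : ∀ p r q s d → (p * r + q * s) * d ≡ p * (r * d) + q * (s * d)
      expand = solve-∀

    reduce : (∃ λ δ → Kernel T (map elim rows) δ × ∃ λ a → a ∈ T × δ a ≢ 0ℤ)
           ⊎ (∀ δ → Kernel T (map elim rows) δ → ∀ {a} → a ∈ T → δ a ≡ 0ℤ)
           → (∃ λ δ → Kernel (x ∷ T) rows δ × ∃ λ a → a ∈ x ∷ T × δ a ≢ 0ℤ)
           ⊎ (∀ δ → Kernel (x ∷ T) rows δ → ∀ {a} → a ∈ x ∷ T → δ a ≡ 0ℤ)
    reduce (inj₁ (δ , ker , a , a∈ , δa≢0)) =
      inj₁ (δ′ , All.map (λ {ρ} → lift {ρ}) (Allₚ.map⁻ ker) , a , there a∈ , nonzero)
      where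
      Sπ = ∑ T (λ a → π a * δ a)

      -- The value at `x` is chosen to solve row `π`; the factor `π x` on `T` keeps it an integer.
      δ′ : A → ℤ
      δ′ b = if does (b ≟ x) then - Sπ else π x * δ b

      δ′-x : δ′ x ≡ - Sπ
      δ′-x = cong (if_then - Sπ else π x * δ x) (dec-true (x ≟ x) refl)

      δ′-T : ∀ {b} → b ∈ T → δ′ b ≡ π x * δ b
      δ′-T {b} b∈ = cong (if_then - Sπ else π x * δ b)
        (dec-false (b ≟ x) (λ { refl → All.lookup x∉ b∈ refl }))

      nonzero : δ′ a ≢ 0ℤ
      nonzero e with ℤₚ.i*j≡0⇒i≡0∨j≡0 (π x) (trans (sym (δ′-T a∈)) e)
      ... | inj₁ z = πx≢0 z
      ... | inj₂ z = δa≢0 z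

      lift : ∀ {ρ} → ∑ T (λ a → elim ρ a * δ a) ≡ 0ℤ → ∑ (x ∷ T) (λ a → ρ a * δ′ a) ≡ 0ℤ
      lift {ρ} z = begin
        ρ x * δ′ x + ∑ T (λ a → ρ a * δ′ a)
          ≡⟨ cong₂ _+_ (cong (ρ x *_) δ′-x) (trans (∑-cong T (λ {a} i →
               trans (cong (ρ a *_) (δ′-T i)) (swap (ρ a) (π x) (δ a)))) (∑-scale T (π x) _)) ⟩
        ρ x * (- Sπ) + π x * ∑ T (λ a → ρ a * δ a)
          ≡⟨ rearrange (ρ x) Sπ (π x * ∑ T (λ a → ρ a * δ a)) ⟩
        π x * ∑ T (λ a → ρ a * δ a) + (- ρ x) * Sπ
          ≡⟨ ∑-elim ρ δ ⟨
        ∑ T (λ a → elim ρ a * δ a)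
          ≡⟨ z ⟩
        0ℤ ∎
        where
        swap : ∀ r p d → r * (p * d) ≡ p * (r * d)
        swap = solve-∀
        rearrange : ∀ r s t → r * (- s) + t ≡ t + (- r) * s
        rearrange = solve-∀
    reduce (inj₂ trivial) = inj₂ zero-kernel
      where
      zero-kernel : ∀ δ → Kernel (x ∷ T) rows δ → ∀ {a} → a ∈ x ∷ T → δ a ≡ 0ℤ
      zero-kernel δ ker = on-list
        where
        descend : ∀ {ρ} → ∑ (x ∷ T) (λ a → ρ a * δ a) ≡ 0ℤ → ∑ T (λ a → elim ρ a * δ a) ≡ 0ℤ
        descend {ρ} z = begin
          ∑ T (λ a → elim ρ a * δ a)   ≡⟨ ∑-elim ρ δ ⟩
          π x * Sρ + (- ρ x) * Sπ      ≡⟨ combine (π x) (ρ x) (δ x) Sρ Sπ ⟩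
          π x * (ρ x * δ x + Sρ) + (- ρ x) * (π x * δ x + Sπ)
            ≡⟨ cong₂ (λ s t → π x * s + (- ρ x) * t) z (All.lookup ker π∈) ⟩
          π x * 0ℤ + (- ρ x) * 0ℤ      ≡⟨ vanish (π x) (- ρ x) ⟩
          0ℤ ∎
          where
          Sρ = ∑ T (λ a → ρ a * δ a)
          Sπ = ∑ T (λ a → π a * δ a)
          combine : ∀ p r d s t → p * s + (- r) * t ≡ p * (r * d + s) + (- r) * (p * d + t)
          combine = solve-∀
          vanish : ∀ p q → p * 0ℤ + q * 0ℤ ≡ 0ℤ
          vanish = solve-∀

        on-T : ∀ {a} → a ∈ T → δ a ≡ 0ℤ
        on-T = trivial δ (Allₚ.map⁺ (All.map (λ {ρ} → descend {ρ}) ker))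

        πx*δx≡0 : π x * δ x ≡ 0ℤ
        πx*δx≡0 = begin
          π x * δ x                    ≡⟨ ℤₚ.+-identityʳ (π x * δ x) ⟨
          π x * δ x + 0ℤ               ≡⟨ cong (λ s → π x * δ x + s) (trans (∑-cong T (λ {a} i →
                                            trans (cong (π a *_) (on-T i)) (ℤₚ.*-zeroʳ (π a)))) (∑-zero T)) ⟨
          ∑ (x ∷ T) (λ a → π a * δ a)  ≡⟨ All.lookup ker π∈ ⟩
          0ℤ                           ∎

        on-list : ∀ {a} → a ∈ x ∷ T → δ a ≡ 0ℤ
        on-list (there i)   = on-T i
        on-list (here refl) = [ (λ z → contradiction z πx≢0) , id ]′ (ℤₚ.i*j≡0⇒i≡0∨j≡0 (π x) πx*δx≡0)

-- i minimises y i / (− d i) among the indices with d i < 0; denominators are cleared.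
ratio-min : ∀ (T : List A) (y d : A → ℤ) → (∀ {a} → a ∈ T → 0ℤ < y a) → ∀ {a} → a ∈ T → d a < 0ℤ →
            ∃ λ i → i ∈ T × d i < 0ℤ × (∀ {a} → a ∈ T → 0ℤ ≤ (- d i) * y a + y i * d a)
ratio-min (x ∷ T) y d y>0 {a} a∈ da<0 with Any.any? (λ a → d a ℤₚ.<? 0ℤ) T
... | no none = x , here refl , dx<0 a∈ , bound
  where
  dx<0 : a ∈ x ∷ T → d x < 0ℤ
  dx<0 (here refl) = da<0
  dx<0 (there i)   = contradiction (lose i da<0) none

  cancel : ∀ d y → 0ℤ ≡ (- d) * y + y * d
  cancel = solve-∀

  bound : ∀ {a} → a ∈ x ∷ T → 0ℤ ≤ (- d x) * y a + y x * d a
  bound (here refl) = ℤₚ.≤-reflexive (cancel (d x) (y x))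
  bound (there i)   = 0≤+ (0≤* (0≤neg (dx<0 a∈)) (ℤₚ.<⇒≤ (y>0 (there i))))
                          (0≤* (ℤₚ.<⇒≤ (y>0 (here refl))) (ℤₚ.≮⇒≥ (All.lookup (Allₚ.¬Any⇒All¬ T none) i)))
... | yes some with find some
... | _ , j∈ , dj<0 with ratio-min T y d (y>0 ∘ there) j∈ dj<0
... | i , i∈ , di<0 , bound with 0ℤ ℤₚ.≤? (- d i) * y x + y i * d x
... | yes p = i , there i∈ , di<0 , λ { (here refl) → p ; (there k) → bound k }
... | no ¬p = x , here refl , dx<0 , bound′
  where
  worse : (- d i) * y x + y i * d x < 0ℤ
  worse = ℤₚ.≰⇒> ¬p

  dx<0 : d x < 0ℤ
  dx<0 with d x ℤₚ.<? 0ℤ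
  ... | yes q = q
  ... | no ¬q = contradiction (0≤+ (0≤* (0≤neg di<0) (ℤₚ.<⇒≤ (y>0 (here refl))))
                                   (0≤* (ℤₚ.<⇒≤ (y>0 (there i∈))) (ℤₚ.≮⇒≥ ¬q))) ¬p

  cancel : ∀ d y → 0ℤ ≡ (- d) * y + y * d
  cancel = solve-∀

  -- Transitivity of comparing ratios: `i` bounds `a` and `x` beats `i`, so `x` bounds `a`. The
  -- positive factor `- di` is cancelled afterwards.
  transfer : ∀ di dx da yi yx ya →
    (- dx) * ((- di) * ya + yi * da) + (- da) * (- ((- di) * yx + yi * dx)) ≡ (- di) * ((- dx) * ya + yx * da)
  transfer = solve-∀

  bound′ : ∀ {a} → a ∈ x ∷ T → 0ℤ ≤ (- d x) * y a + y x * d a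
  bound′ (here refl)   = ℤₚ.≤-reflexive (cancel (d x) (y x))
  bound′ {a} (there k) with d a ℤₚ.<? 0ℤ
  ... | no ¬q = 0≤+ (0≤* (0≤neg dx<0) (ℤₚ.<⇒≤ (y>0 (there k)))) (0≤* (ℤₚ.<⇒≤ (y>0 (here refl))) (ℤₚ.≮⇒≥ ¬q))
  ... | yes q = *-cancel-0≤ (- d i) (0<neg di<0) (subst (0ℤ ≤_) (transfer (d i) (d x) (d a) (y i) (y x) (y a))
                  (0≤+ (0≤* (0≤neg dx<0) (bound k)) (0≤* (0≤neg q) (0≤neg worse))))

∈-replicate⁻ : ∀ k {x y : A} → x ∈ replicate k y → x ≡ y × k ≢ 0
∈-replicate⁻ (suc k) (here refl) = refl , λ ()
∈-replicate⁻ (suc k) (there i)   = proj₁ (∈-replicate⁻ k i) , λ ()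

∈-copies⁺ : ∀ k {x : A} {xs} → NonZero k → x ∈ xs → x ∈ copies k xs
∈-copies⁺ (suc k) _ i = ∈-++⁺ˡ i

∈-copies⁻ : ∀ k {x : A} {xs} → x ∈ copies k xs → x ∈ xs
∈-copies⁻ (suc k) {xs = xs} i with ∈-++⁻ xs i
... | inj₁ j = j
... | inj₂ j = ∈-copies⁻ k j

-- Decomposition of feasible points into rigid ones

-- The list `L` encodes a vector by its multiplicities, which makes nonnegativity automatic; `b` is
-- the denominator of the rational point, and `OK` selects the admissible coordinates.
record Feasible {A : Set} {m : ℕ} (OK : A → Set) (row : Fin m → A → ℤ) (β : Fin m → ℤ)
                (b : ℕ) (L : List A) : Set where
  field
    ok    : ∀ {a} → a ∈ L → OK a
    meets : ∀ r → ∑ L (row r) ≡ + b * β r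
open Feasible public

module Decomposition {A : Set} (_≟_ : DecidableEquality A) {m : ℕ} (OK : A → Set)
                     (row : Fin m → A → ℤ) (β : Fin m → ℤ)
                     (r₀ : Fin m) (row-pos : ∀ a → 0ℤ < row r₀ a) where
  open Multiplicity _≟_
  open Elimination _≟_

  -- Vertices: up to scaling there is at most one feasible point supported in L.
  Rigid : List A → Set
  Rigid L = ∀ {b₁ L₁ b₂ L₂} → Feasible OK row β b₁ L₁ → Feasible OK row β b₂ L₂ →
            (∀ {a} → a ∈ L₁ → a ∈ L) → (∀ {a} → a ∈ L₂ → a ∈ L) →
            ∀ φ → + b₂ * ∑ L₁ φ ≡ + b₁ * ∑ L₂ φ

  Direction : List A → (A → ℤ) → Set
  Direction T d = ∀ r → ∑ T (λ a → row r a * d a) ≡ 0ℤ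

  -- A nonzero direction with no negative entry would have a positive product with the strictly
  -- positive row `r₀`. This is the boundedness of the polytope.
  descending : ∀ {T d} → Direction T d → ∀ {a} → a ∈ T → d a ≢ 0ℤ → ∃ λ i → i ∈ T × d i < 0ℤ
  descending {T} {d} dir {a} a∈ da≢0 with Any.any? (λ a → d a ℤₚ.<? 0ℤ) T
  ... | yes some = find some
  ... | no none = contradiction (sym (dir r₀)) (ℤₚ.<⇒≢ (∑-pos T _
          (λ i → 0≤* (ℤₚ.<⇒≤ (row-pos _)) (d≥0 i)) a∈
          (0<* (row-pos a) (ℤₚ.≤∧≢⇒< (d≥0 a∈) (da≢0 ∘ sym)))))
    where
    d≥0 : ∀ {a} → a ∈ T → 0ℤ ≤ d a
    d≥0 i = ℤₚ.≮⇒≥ (All.lookup (Allₚ.¬Any⇒All¬ T none) i)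

  without : A → List A → List A
  without i = filter (λ a → ¬? (a ≟ i))

  -- As a vector of multiplicities, `L′` is `c` times `L` plus `y` times `d`. Scaling by `c` clears
  -- the denominator of the step length and multiplies the fold.
  record Pushed (b : ℕ) (L T : List A) (d : A → ℤ) : Set where
    field
      {c y}     : ℕ
      {i}       : A
      {L′}      : List A
      c≢0       : NonZero c
      y≢0       : NonZero y
      i∈        : i ∈ T
      feasible  : Feasible OK row β (c ℕ.* b) L′
      shrinks   : ∀ {a} → a ∈ L′ → a ∈ without i T
      moved     : ∀ φ → ∑ L′ φ ≡ + c * ∑ L φ + + y * ∑ T (λ a → φ a * d a)

  -- Moving from L along d as far as nonnegativity allows empties the multiplicity of some i.
  push : ∀ {b L T d} → Unique T → (∀ {a} → a ∈ L → a ∈ T) → (∀ {a} → a ∈ T → a ∈ L) →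
         Feasible OK row β b L → Direction T d → ∀ {a} → a ∈ T → d a ≢ 0ℤ → Pushed b L T d
  push {b} {L} {T} {d} u L⊆T T⊆L feas dir {a} a∈ da≢0
    with descending dir a∈ da≢0
  ... | _ , j∈ , dj<0 with ratio-min T (mult L) d (mult-pos ∘ T⊆L) j∈ dj<0
  ... | i , i∈ , di<0 , bound = record
    { c        = c
    ; y        = y
    ; L′       = L′
    ; c≢0      = ℕ.≢-nonZero (λ z → ℤₚ.<⇒≢ (0<neg di<0) (sym (trans (sym +c) (cong +_ z))))
    ; y≢0      = ℕ.≢-nonZero (λ z → ℤₚ.<⇒≢ (mult-pos (T⊆L i∈)) (sym (trans (sym +y) (cong +_ z))))
    ; i∈       = i∈
    ; feasible = record
      { ok    = λ k → ok feas (T⊆L (proj₁ (∈-filter⁻ _ {xs = T} (shrinks′ k))))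
      ; meets = λ r → trans (moved′ (row r)) (trans
                  (cong₂ (λ s t → + c * s + + y * t) (meets feas r) (dir r))
                  (trans (assemble (+ c) (+ b) (β r) (+ y)) (cong (_* β r) (sym (ℤₚ.pos-* c b)))))
      }
    ; shrinks  = shrinks′
    ; moved    = moved′
    }
    where
    open ≡-Reasoning
    -- The step length is the minimal ratio `mult L i` over `- d i`. With these `c` and `y` the
    -- weight `w i` cancels to zero, while `bound` makes every `w a` nonnegative, so the absolute
    -- value in `L′` changes nothing.
    c = ∣ - d i ∣
    y = ∣ mult L i ∣

    +c : + c ≡ - d i
    +c = ℤₚ.0≤i⇒+∣i∣≡i (0≤neg di<0)

    +y : + y ≡ mult L i
    +y = ℤₚ.0≤i⇒+∣i∣≡i (mult-nonneg L i)

    w : A → ℤ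
    w a = (- d i) * mult L a + mult L i * d a

    L′ = concatMap (λ a → replicate ∣ w a ∣ a) T

    assemble : ∀ c b β y → c * (b * β) + y * 0ℤ ≡ c * b * β
    assemble = solve-∀

    moved′ : ∀ φ → ∑ L′ φ ≡ + c * ∑ L φ + + y * ∑ T (λ a → φ a * d a)
    moved′ φ = begin
      ∑ L′ φ
        ≡⟨ ∑-concatMap (λ a → replicate ∣ w a ∣ a) T φ ⟩
      ∑ T (λ a → ∑ (replicate ∣ w a ∣ a) φ)
        ≡⟨ ∑-cong T (λ {a} k → trans (∑-replicate ∣ w a ∣ a φ)
             (trans (cong (_* φ a) (ℤₚ.0≤i⇒+∣i∣≡i (bound k)))
                    (expand (- d i) (mult L a) (mult L i) (d a) (φ a)))) ⟩
      ∑ T (λ a → (- d i) * (mult L a * φ a) + mult L i * (φ a * d a))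
        ≡⟨ ∑-linear T (- d i) (mult L i) (λ a → mult L a * φ a) (λ a → φ a * d a) ⟩
      (- d i) * ∑ T (λ a → mult L a * φ a) + mult L i * ∑ T (λ a → φ a * d a)
        ≡⟨ cong₂ _+_ (cong₂ _*_ (sym +c) (sym (∑-by-mult u L L⊆T φ)))
                     (cong (_* ∑ T (λ a → φ a * d a)) (sym +y)) ⟩
      + c * ∑ L φ + + y * ∑ T (λ a → φ a * d a) ∎
      where
      expand : ∀ c l y d f → (c * l + y * d) * f ≡ c * (l * f) + y * (f * d)
      expand = solve-∀

    w-i : w i ≡ 0ℤ
    w-i = cancel (d i) (mult L i)
      where
      cancel : ∀ d y → (- d) * y + y * d ≡ 0ℤ
      cancel = solve-∀

    shrinks′ : ∀ {a} → a ∈ L′ → a ∈ without i T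
    shrinks′ {a} k with find (∈-concatMap⁻ (λ a → replicate ∣ w a ∣ a) {xs = T} k)
    ... | e , e∈ , a∈e with ∈-replicate⁻ ∣ w e ∣ a∈e
    ... | refl , ≢0 = ∈-filter⁺ (λ a → ¬? (a ≟ i)) e∈ (λ { refl → ≢0 (cong ∣_∣ w-i) })

  -- An induction principle for feasible points: `Q` spreads from rigid points to all points along
  -- convex combinations, written with integer coefficients `k`, `k₁`, `k₂`.
  module _
    (Q : ℕ → List A → Set)
    (join : ∀ {b L b₁ L₁ b₂ L₂} (k k₁ k₂ : ℕ) → NonZero k → Q b₁ L₁ → Q b₂ L₂ →
            k ℕ.* b ≡ k₁ ℕ.* b₁ ℕ.+ k₂ ℕ.* b₂ →
            (∀ φ → + k * ∑ L φ ≡ + k₁ * ∑ L₁ φ + + k₂ * ∑ L₂ φ) → Q b L)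
    (rigid : ∀ {b L} → NonZero b → Feasible OK row β b L → Rigid L → Q b L)
    where

    private
      -- The recursion is on `N`, a bound on the size of the support: `T₀` covers the support, `T`
      -- is exactly the support, and each push removes an element of it.
      decompose′ : ∀ N {T b L} → length T ℕ.≤ N → Unique T → (∀ {a} → a ∈ L → a ∈ T) →
                   NonZero b → Feasible OK row β b L → Q b L
      decompose′ N {T₀} {b} {L} T₀≤N u₀ L⊆T₀ b≢0 feas = dichotomy (kernel? T u (tabulate row))
        where
        T = filter (_∈? L) T₀
        u = Unique-filter⁺ (_∈? L) u₀

        T⊆L : ∀ {a} → a ∈ T → a ∈ L
        T⊆L k = proj₂ (∈-filter⁻ (_∈? L) {xs = T₀} k)

        L⊆T : ∀ {a} → a ∈ L → a ∈ T
        L⊆T k = ∈-filter⁺ (_∈? L) (L⊆T₀ k) k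

        recurse : ∀ N {d} → length T₀ ℕ.≤ N → (p : Pushed b L T d) → Q (Pushed.c p ℕ.* b) (Pushed.L′ p)
        -- The emptied index belongs to `T`, so `T₀` cannot be empty.
        recurse zero T₀≤0 p with () ← ℕₚ.≤-trans (ℕₚ.≤-trans (∈-length (Pushed.i∈ p)) (length-filter (_∈? L) T₀)) T₀≤0
        recurse (suc N) T₀≤N p = decompose′ N {without i T} shorter (Unique-filter⁺ _ u) shrinks
                                   (ℕₚ.m*n≢0 c b {{c≢0}} {{b≢0}}) feasible
          where
          open Pushed p
          shorter : length (without i T) ℕ.≤ N
          shorter = ℕₚ.≤-pred (ℕₚ.≤-trans (filter-notAll _ T (lose i∈ (λ ne → ne refl)))
                      (ℕₚ.≤-trans (length-filter (_∈? L) T₀) T₀≤N))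

        split : ∀ {d} → Pushed b L T d → Pushed b L T (λ a → - d a) → Q b L
        -- The step lengths are crossed: `P′.y` times the displacement `P.y * d` cancels against
        -- `P.y` times the displacement `- P′.y * d`.
        split {d} p p′ = join (P′.y ℕ.* P.c ℕ.+ P.y ℕ.* P′.c) P′.y P.y
            (ℕ.>-nonZero (ℕₚ.<-≤-trans (ℕ.>-nonZero⁻¹ _ {{ℕₚ.m*n≢0 P′.y P.c {{P′.y≢0}} {{P.c≢0}}}}) (ℕₚ.m≤m+n _ _)))
            (recurse N T₀≤N p) (recurse N T₀≤N p′)
            folds sums
          where
          module P  = Pushed p
          module P′ = Pushed p′

          folds : (P′.y ℕ.* P.c ℕ.+ P.y ℕ.* P′.c) ℕ.* b ≡ P′.y ℕ.* (P.c ℕ.* b) ℕ.+ P.y ℕ.* (P′.c ℕ.* b)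
          folds = trans (ℕₚ.*-distribʳ-+ b (P′.y ℕ.* P.c) _) (cong₂ ℕ._+_ (ℕₚ.*-assoc P′.y P.c b) (ℕₚ.*-assoc P.y P′.c b))

          sums : ∀ φ → + (P′.y ℕ.* P.c ℕ.+ P.y ℕ.* P′.c) * ∑ L φ ≡ + P′.y * ∑ P.L′ φ + + P.y * ∑ P′.L′ φ
          sums φ = begin
            + (P′.y ℕ.* P.c ℕ.+ P.y ℕ.* P′.c) * ∑ L φ
              ≡⟨ cong (_* ∑ L φ) (cong₂ _+_ (ℤₚ.pos-* P′.y P.c) (ℤₚ.pos-* P.y P′.c)) ⟩
            (+ P′.y * + P.c + + P.y * + P′.c) * ∑ L φ
              ≡⟨ cancel (+ P′.y) (+ P.c) (+ P.y) (+ P′.c) (∑ L φ) D ⟩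
            + P′.y * (+ P.c * ∑ L φ + + P.y * D) + + P.y * (+ P′.c * ∑ L φ + + P′.y * (- D))
              ≡⟨ cong₂ (λ s t → + P′.y * s + + P.y * t) (sym (P.moved φ))
                   (sym (trans (P′.moved φ) (cong (λ s → + P′.c * ∑ L φ + + P′.y * s) negated))) ⟩
            + P′.y * ∑ P.L′ φ + + P.y * ∑ P′.L′ φ ∎
            where
            open ≡-Reasoning
            D = ∑ T (λ a → φ a * d a)
            cancel : ∀ y′ c y c′ s D → (y′ * c + y * c′) * s ≡ y′ * (c * s + y * D) + y * (c′ * s + y′ * (- D))
            cancel = solve-∀
            neg-out : ∀ f d → f * (- d) ≡ (- 1ℤ) * (f * d)
            neg-out = solve-∀
            negated : ∑ T (λ a → φ a * (- d a)) ≡ - D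
            negated = trans (∑-cong T (λ {a} _ → neg-out (φ a) (d a)))
                        (trans (∑-scale T (- 1ℤ) (λ a → φ a * d a)) (ℤₚ.-1*i≡-i D))

        dichotomy : (∃ λ δ → Kernel T (tabulate row) δ × ∃ λ a → a ∈ T × δ a ≢ 0ℤ)
                  ⊎ (∀ δ → Kernel T (tabulate row) δ → ∀ {a} → a ∈ T → δ a ≡ 0ℤ) → Q b L
        dichotomy (inj₁ (d , ker , a , a∈ , da≢0)) =
          split (push u L⊆T T⊆L feas dir a∈ da≢0)
                (push u L⊆T T⊆L feas opposite a∈ (λ z → da≢0 (trans (sym (ℤₚ.neg-involutive (d a))) (cong -_ z))))
          where
          dir : Direction T d
          dir = Allₚ.tabulate⁻ ker

          opposite : Direction T (λ a → - d a)
          opposite r = trans (∑-cong T (λ {a} _ → neg-out (row r a) (d a)))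
                         (trans (∑-scale T (- 1ℤ) (λ a → row r a * d a)) (cong ((- 1ℤ) *_) (dir r)))
            where
            neg-out : ∀ f d → f * (- d) ≡ (- 1ℤ) * (f * d)
            neg-out = solve-∀
        dichotomy (inj₂ trivial) = rigid b≢0 feas rigidity
          where
          rigidity : Rigid L
          rigidity {b₁} {L₁} {b₂} {L₂} feas₁ feas₂ L₁⊆L L₂⊆L φ = begin
            + b₂ * ∑ L₁ φ                                 ≡⟨ add (+ b₂ * ∑ L₁ φ) (+ b₁) (∑ L₂ φ) ⟩
            (+ b₂ * ∑ L₁ φ + (- + b₁) * ∑ L₂ φ) + + b₁ * ∑ L₂ φ
              ≡⟨ cong (λ s → s + + b₁ * ∑ L₂ φ) (trans (sym (∑-δ φ)) (trans (∑-cong T (λ {a} k →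
                   trans (cong (φ a *_) (trivial δ (Allₚ.tabulate⁺ kernel) k)) (ℤₚ.*-zeroʳ (φ a)))) (∑-zero T))) ⟩
            0ℤ + + b₁ * ∑ L₂ φ                            ≡⟨ ℤₚ.+-identityˡ _ ⟩
            + b₁ * ∑ L₂ φ                                 ∎
            where
            open ≡-Reasoning
            add : ∀ s b t → s ≡ (s + (- b) * t) + b * t
            add = solve-∀

            -- Both points meet the same right-hand side `β` up to their folds, so this
            -- cross-weighted difference lies in the kernel and must vanish on `T`.
            δ : A → ℤ
            δ a = + b₂ * mult L₁ a + (- + b₁) * mult L₂ a

            ∑-δ : ∀ φ → ∑ T (λ a → φ a * δ a) ≡ + b₂ * ∑ L₁ φ + (- + b₁) * ∑ L₂ φ
            ∑-δ φ = trans (∑-cong T (λ {a} _ → expand (φ a) (+ b₂) (mult L₁ a) (- + b₁) (mult L₂ a)))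
              (trans (∑-linear T (+ b₂) (- + b₁) (λ a → mult L₁ a * φ a) (λ a → mult L₂ a * φ a))
                (cong₂ (λ s t → + b₂ * s + (- + b₁) * t)
                  (sym (∑-by-mult u L₁ (L⊆T ∘ L₁⊆L) φ)) (sym (∑-by-mult u L₂ (L⊆T ∘ L₂⊆L) φ))))
              where
              expand : ∀ f b m c n → f * (b * m + c * n) ≡ b * (m * f) + c * (n * f)
              expand = solve-∀

            kernel : ∀ r → ∑ T (λ a → row r a * δ a) ≡ 0ℤ
            kernel r = trans (∑-δ (row r)) (trans
              (cong₂ (λ s t → + b₂ * s + (- + b₁) * t) (meets feas₁ r) (meets feas₂ r))
              (cancel (+ b₂) (+ b₁) (β r)))
              where
              cancel : ∀ b c β → b * (c * β) + (- c) * (b * β) ≡ 0ℤ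
              cancel = solve-∀

    decompose : ∀ {b L} → NonZero b → Feasible OK row β b L → Q b L
    decompose {b} {L} = decompose′ (length T) {T} ℕₚ.≤-refl (UniqueDec.deduplicate-! _≟_ L) (∈-deduplicate⁺ _≟_)
      where T = deduplicate _≟_ L

-- Injective renamings of duplicate-free lists

Unique-map-on : ∀ (f : A → B) {xs} → (∀ {x y} → x ∈ xs → y ∈ xs → f x ≡ f y → x ≡ y) →
                Unique xs → Unique (map f xs)
Unique-map-on f {[]}     inj []       = []
Unique-map-on f {x ∷ xs} inj (x∉ ∷ u) =
  Allₚ.map⁺ (All.tabulate (λ i e → All.lookup x∉ i (inj (here refl) (there i) e)))
  ∷ Unique-map-on f (λ i j → inj (there i) (there j)) u

Unique-map-injective : ∀ (f : A → B) {xs} → Unique (map f xs) →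
                       ∀ {x y} → x ∈ xs → y ∈ xs → f x ≡ f y → x ≡ y
Unique-map-injective f (_  ∷ _) (here refl) (here refl) e = refl
Unique-map-injective f (x∉ ∷ _) (here refl) (there j)   e = contradiction e (All.lookup (Allₚ.map⁻ x∉) j)
Unique-map-injective f (x∉ ∷ _) (there i)   (here refl) e = contradiction (sym e) (All.lookup (Allₚ.map⁻ x∉) i)
Unique-map-injective f (_  ∷ u) (there i)   (there j)   e = Unique-map-injective f u i j e

same-members⇒↭ : ∀ {xs ys : List A} → Unique xs → Unique ys →
                 (∀ {x} → x ∈ xs → x ∈ ys) → (∀ {x} → x ∈ ys → x ∈ xs) → xs ↭ ys
same-members⇒↭ u v to from = ∼bag⇒↭ (unique∧set⇒bag u v (mk⇔ to from))

map-≡⇒≗ : ∀ {f g : A → B} xs → map f xs ≡ map g xs → ∀ {x} → x ∈ xs → f x ≡ g x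
map-≡⇒≗ (x ∷ xs) eq (here refl) = proj₁ (∷-injective eq)
map-≡⇒≗ (x ∷ xs) eq (there i)   = map-≡⇒≗ xs (proj₂ (∷-injective eq)) i

∑-filter : ∀ {P : A → Set} (P? : ∀ x → Dec (P x)) xs φ → (∀ x → ¬ P x → φ x ≡ 0ℤ) →
           ∑ (filter P? xs) φ ≡ ∑ xs φ
∑-filter P? []       φ off = refl
∑-filter P? (x ∷ xs) φ off with P? x
... | yes _ = cong (λ s → φ x + s) (∑-filter P? xs φ off)
... | no ¬p = trans (∑-filter P? xs φ off) (sym (trans (cong (_+ ∑ xs φ) (off x ¬p)) (ℤₚ.+-identityˡ _)))

-- `Iso` asks for a renaming defined on all natural numbers: positions determine it on `xs`, and
-- elsewhere it falls back on `id`.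
matching : ∀ (xs ys : List ℕ) → Unique xs → length xs ≡ length ys → ∃ λ (f : ℕ → ℕ) → map f xs ≡ ys
matching []       []       _        _ = id , refl
matching (x ∷ xs) (y ∷ ys) (x∉ ∷ u) e with matching xs ys u (ℕₚ.suc-injective e)
... | f , refl = f′ , cong₂ _∷_ f′-x (map-cong-local (All.tabulate f′-xs))
  where
  f′ : ℕ → ℕ
  f′ z = if does (z ℕ.≟ x) then y else f z

  f′-x : f′ x ≡ y
  f′-x = cong (if_then y else f x) (dec-true (x ℕ.≟ x) refl)

  f′-xs : ∀ {z} → z ∈ xs → f′ z ≡ f z
  f′-xs {z} i = cong (if_then y else f z) (dec-false (z ℕ.≟ x) (λ { refl → All.lookup x∉ i refl }))

-- Colour classes

-- A colour is recorded by its class, the indicator vector of the vertices carrying it;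
-- the empty class stands for an unused colour.
Class : ℕ → Set
Class n = Vec Bool n

∅ : Class n
∅ = Vec.replicate _ false

_≟ᶜ_ : DecidableEquality (Class n)
_≟ᶜ_ = Vecₚ.≡-dec Bool._≟_

class-ext : {S S′ : Class n} → (∀ v → lookup S v ≡ true → lookup S′ v ≡ true) →
            (∀ v → lookup S′ v ≡ true → lookup S v ≡ true) → S ≡ S′
class-ext {S = S} {S′} to from = trans (sym (Vecₚ.tabulate∘lookup S))
  (trans (Vecₚ.tabulate-cong (λ v → agree (lookup S v) (lookup S′ v) (to v) (from v))) (Vecₚ.tabulate∘lookup S′))
  where
  agree : ∀ a b → (a ≡ true → b ≡ true) → (b ≡ true → a ≡ true) → a ≡ b
  agree true  b     p q = sym (p refl)
  agree false true  p q = q refl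
  agree false false p q = refl

∉∅ : ∀ (v : Fin n) → lookup ∅ v ≢ true
∉∅ v e with trans (sym (Vecₚ.lookup-replicate v false)) e
... | ()

≢∅⇒inhabited : {S : Class n} → S ≢ ∅ → ∃ λ v → lookup S v ≡ true
≢∅⇒inhabited {S = S} ne with Finₚ.any? (λ v → lookup S v Bool.≟ true)
... | yes p   = p
... | no none = contradiction (class-ext (λ v e → contradiction (v , e) none) (λ v e → contradiction e (∉∅ v))) ne

colors : RawCol n → List ℕ
colors c = deduplicate ℕ._≟_ (usedColors c)

∈-used⁺ : ∀ (c : RawCol n) {v x} → x ∈ c v → x ∈ usedColors c
∈-used⁺ c {v} i = ∈-concatMap⁺ c (lose (∈-allFin v) i)

∈-used⁻ : ∀ (c : RawCol n) {x} → x ∈ usedColors c → ∃ λ v → x ∈ c v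
∈-used⁻ {n} c i with find (∈-concatMap⁻ c {xs = allFin n} i)
... | v , _ , k = v , k

∈-colors⁺ : ∀ (c : RawCol n) {v x} → x ∈ c v → x ∈ colors c
∈-colors⁺ c i = ∈-deduplicate⁺ ℕ._≟_ (∈-used⁺ c i)

∈-colors⁻ : ∀ (c : RawCol n) {x} → x ∈ colors c → ∃ λ v → x ∈ c v
∈-colors⁻ c i = ∈-used⁻ c (∈-deduplicate⁻ ℕ._≟_ (usedColors c) i)

colors-! : ∀ (c : RawCol n) → Unique (colors c)
colors-! c = UniqueDec.deduplicate-! ℕ._≟_ (usedColors c)

open import Data.List.Membership.DecPropositional ℕ._≟_ using () renaming (_∈?_ to _∈ℕ?_)

class : RawCol n → ℕ → Class n
class c x = Vec.tabulate (λ v → does (x ∈ℕ? c v))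

∈-class⁺ : ∀ (c : RawCol n) {v x} → x ∈ c v → lookup (class c x) v ≡ true
∈-class⁺ c {v} {x} i = trans (Vecₚ.lookup∘tabulate _ v) (dec-true (x ∈ℕ? c v) i)

∈-class⁻ : ∀ (c : RawCol n) {v x} → lookup (class c x) v ≡ true → x ∈ c v
∈-class⁻ c {v} {x} e = holds (trans (sym (Vecₚ.lookup∘tabulate _ v)) e)
  where
  holds : does (x ∈ℕ? c v) ≡ true → x ∈ c v
  holds e with x ∈ℕ? c v
  ... | yes i = i
  holds () | no _

class≢∅ : ∀ (c : RawCol n) {x} → x ∈ colors c → class c x ≢ ∅
class≢∅ c i e with ∈-colors⁻ c i
... | v , k = ∉∅ v (subst (λ S → lookup S v ≡ true) e (∈-class⁺ c k))

-- A table of colours with their classes. It may contain keys with an empty class, which leave no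
-- trace in `c`; hence `c` determines the list of classes only up to order and copies of `∅`.
record Presents {n} (c : RawCol n) (X : List (ℕ × Class n)) : Set where
  field
    keys-! : Unique (map proj₁ X)
    uniq   : ∀ v → Unique (c v)
    sound  : ∀ {v x} → x ∈ c v → ∃ λ S → (x , S) ∈ X × lookup S v ≡ true
    compl  : ∀ {v x S} → (x , S) ∈ X → lookup S v ≡ true → x ∈ c v

  entry-class : ∀ {x S} → (x , S) ∈ X → S ≡ class c x
  entry-class {x} {S} i = class-ext (λ v e → ∈-class⁺ c (compl i e)) from
    where
    from : ∀ v → lookup (class c x) v ≡ true → lookup S v ≡ true
    from v e with sound (∈-class⁻ c e)
    ... | S′ , j , e′ with Unique-map-injective proj₁ keys-! i j refl
    ... | refl = e′

infix 4 _⊨_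
_⊨_ : RawCol n → List (Class n) → Set
c ⊨ L = ∃ λ X → Presents c X × map proj₂ X ≡ L

⊨-classes : ∀ (c : RawCol n) → (∀ v → Unique (c v)) → c ⊨ map (class c) (colors c)
⊨-classes c u = map entry (colors c) , record
    { keys-! = subst Unique (trans (sym (map-id (colors c))) (map-∘ (colors c))) (colors-! c)
    ; uniq   = u
    ; sound  = λ {v} {x} i → class c x , ∈-map⁺ entry (∈-colors⁺ c i) , ∈-class⁺ c i
    ; compl  = compl
    } , sym (map-∘ (colors c))
  where
  entry : ℕ → ℕ × Class _
  entry x = x , class c x

  compl : ∀ {v x S} → (x , S) ∈ map entry (colors c) → lookup S v ≡ true → x ∈ c v
  compl i e with ∈-map⁻ entry i
  ... | _ , _ , refl = ∈-class⁻ c e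

⊨-uniq : ∀ {c : RawCol n} {L} → c ⊨ L → ∀ v → Unique (c v)
⊨-uniq (X , pres , _) = Presents.uniq pres

-- The keys with a nonempty class are precisely the used colours, each once, and the other entries
-- contribute `φ ∅`.
∑-classes : ∀ {c : RawCol n} {L} → c ⊨ L → ∀ φ → φ ∅ ≡ 0ℤ → ∑ L φ ≡ ∑ (colors c) (φ ∘ class c)
∑-classes {c = c} (X , pres , refl) φ φ∅ = begin
  ∑ (map proj₂ X) φ              ≡⟨ ∑-map proj₂ X φ ⟩
  ∑ X (φ ∘ proj₂)                ≡⟨ ∑-filter used? X (φ ∘ proj₂) off ⟨
  ∑ X′ (φ ∘ proj₂)               ≡⟨ ∑-cong X′ (λ i → cong φ (entry-class (proj₁ (∈-filter⁻ used? {xs = X} i)))) ⟩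
  ∑ X′ (φ ∘ class c ∘ proj₁)     ≡⟨ ∑-map proj₁ X′ (φ ∘ class c) ⟨
  ∑ (map proj₁ X′) (φ ∘ class c) ≡⟨ ∑-↭ (same-members⇒↭ (AllPairsₚ.map⁺ (AllPairsₚ.filter⁺ used? (AllPairsₚ.map⁻ keys-!)))
                                      (colors-! c) to from) (φ ∘ class c) ⟩
  ∑ (colors c) (φ ∘ class c)     ∎
  where
  open ≡-Reasoning
  open Presents pres

  used? : ∀ e → Dec (proj₂ e ≢ ∅)
  used? e = ¬? (proj₂ e ≟ᶜ ∅)

  X′ = filter used? X

  off : ∀ e → ¬ (proj₂ e ≢ ∅) → φ (proj₂ e) ≡ 0ℤ
  off e ¬ne = trans (cong φ (decidable-stable (proj₂ e ≟ᶜ ∅) ¬ne)) φ∅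

  to : ∀ {x} → x ∈ map proj₁ X′ → x ∈ colors c
  to i with ∈-map⁻ proj₁ i
  ... | (_ , S) , j , refl with ∈-filter⁻ used? {xs = X} j
  ... | k , ne with ≢∅⇒inhabited ne
  ... | v , e = ∈-colors⁺ c (compl k e)

  from : ∀ {x} → x ∈ colors c → x ∈ map proj₁ X′
  from i with ∈-colors⁻ c i
  ... | v , k with sound k
  ... | S , j , e = ∈-map⁺ proj₁ (∈-filter⁺ used? j (λ { refl → ∉∅ v e }))

-- Resets the value at `∅`, so that an arbitrary `φ` fits lemmas demanding `φ ∅ ≡ 0ℤ`.
used : (Class n → ℤ) → Class n → ℤ
used φ S = if does (S ≟ᶜ ∅) then 0ℤ else φ S

used-∅ : ∀ (φ : Class n → ℤ) → used φ ∅ ≡ 0ℤ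
used-∅ {n} φ = cong (if_then 0ℤ else φ ∅) (dec-true (∅ {n} ≟ᶜ ∅) refl)

used-≢ : ∀ (φ : Class n → ℤ) {S} → S ≢ ∅ → used φ S ≡ φ S
used-≢ φ {S} ne = cong (if_then 0ℤ else φ S) (dec-false (S ≟ᶜ ∅) ne)

∑-used : ∀ {c : RawCol n} {L} → c ⊨ L → ∀ φ → ∑ L (used φ) ≡ ∑ (colors c) (φ ∘ class c)
∑-used {c = c} p φ = trans (∑-classes p (used φ) (used-∅ φ)) (∑-cong (colors c) (λ i → used-≢ φ (class≢∅ c i)))

-- A renaming is a bijection between the used colours that preserves the class of each colour.
Iso⇒∑ : ∀ {c c′ : RawCol n} {L L′} → c ⊨ L → c′ ⊨ L′ → Iso c c′ → ∀ φ → φ ∅ ≡ 0ℤ → ∑ L φ ≡ ∑ L′ φ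
Iso⇒∑ {c = c} {c′} {L} {L′} p p′ (f , inj , ren) φ φ∅ = begin
  ∑ L φ                                ≡⟨ ∑-classes p φ φ∅ ⟩
  ∑ (colors c) (φ ∘ class c)           ≡⟨ ∑-cong (colors c) (λ {x} i → cong φ (class-ext (to i) (from i))) ⟩
  ∑ (colors c) (φ ∘ class c′ ∘ f)      ≡⟨ ∑-map f (colors c) (φ ∘ class c′) ⟨
  ∑ (map f (colors c)) (φ ∘ class c′)  ≡⟨ ∑-↭ (same-members⇒↭ (Unique-map-on f inj′ (colors-! c)) (colors-! c′) forth back) (φ ∘ class c′) ⟩
  ∑ (colors c′) (φ ∘ class c′)         ≡⟨ ∑-classes p′ φ φ∅ ⟨
  ∑ L′ φ                               ∎
  where
  open ≡-Reasoning

  inj′ : ∀ {x y} → x ∈ colors c → y ∈ colors c → f x ≡ f y → x ≡ y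
  inj′ i j = inj _ _ (∈-deduplicate⁻ ℕ._≟_ (usedColors c) i) (∈-deduplicate⁻ ℕ._≟_ (usedColors c) j)

  to : ∀ {x} → x ∈ colors c → ∀ v → lookup (class c x) v ≡ true → lookup (class c′ (f x)) v ≡ true
  to i v e = ∈-class⁺ c′ (∈-resp-↭ (↭-sym (ren v)) (∈-map⁺ f (∈-class⁻ c e)))

  from : ∀ {x} → x ∈ colors c → ∀ v → lookup (class c′ (f x)) v ≡ true → lookup (class c x) v ≡ true
  from i v e with ∈-map⁻ f (∈-resp-↭ (ren v) (∈-class⁻ c′ e))
  ... | y , j , eq with inj′ i (∈-colors⁺ c j) eq
  ... | refl = ∈-class⁺ c j

  forth : ∀ {y} → y ∈ map f (colors c) → y ∈ colors c′
  forth i with ∈-map⁻ f i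
  ... | x , j , refl with ∈-colors⁻ c j
  ... | v , k = ∈-colors⁺ c′ (∈-resp-↭ (↭-sym (ren v)) (∈-map⁺ f k))

  back : ∀ {y} → y ∈ colors c′ → y ∈ map f (colors c)
  back i with ∈-colors⁻ c′ i
  ... | v , k with ∈-map⁻ f (∈-resp-↭ (ren v) k)
  ... | x , j , refl = ∈-map⁺ f (∈-colors⁺ c j)

-- Equal sums make the lists of nonempty classes permutations of each other. Pulling the permutation
-- back to colours gives `ys`, an ordering of the colours of `c′` whose classes agree with those of
-- `colors c` position by position; the renaming follows positions.
∑⇒Iso : ∀ {c c′ : RawCol n} {L L′} → c ⊨ L → c′ ⊨ L′ → (∀ φ → φ ∅ ≡ 0ℤ → ∑ L φ ≡ ∑ L′ φ) → Iso c c′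
∑⇒Iso {n} {c} {c′} p p′ eq
  with ↭-map-inv (class c′) (Multiplicity.∑-≡⇒↭ _≟ᶜ_ {xs = map (class c′) (colors c′)} {map (class c) (colors c)} sums)
  where
  sums : ∀ φ → ∑ (map (class c′) (colors c′)) φ ≡ ∑ (map (class c) (colors c)) φ
  sums φ = trans (canonical p′) (trans (sym (eq (used φ) (used-∅ φ))) (sym (canonical p)))
    where
    canonical : ∀ {c L} → c ⊨ L → ∑ (map (class c) (colors c)) φ ≡ ∑ L (used φ)
    canonical {c} q = trans (∑-map (class c) (colors c) φ) (sym (∑-used q φ))
... | ys , classes≡ , c′↭ys with matching (colors c) ys (colors-! c)
      (trans (sym (length-map (class c) (colors c))) (trans (cong length classes≡) (length-map (class c′) ys)))
... | f , refl = f , inj , λ v → ↭-sym (same-members⇒↭ (Unique-map-on f (λ i j → inj′ (∈-colors⁺ c i) (∈-colors⁺ c j)) (⊨-uniq p v))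
                                          (⊨-uniq p′ v) (to v) (from v))
  where
  inj′ : ∀ {x y} → x ∈ colors c → y ∈ colors c → f x ≡ f y → x ≡ y
  inj′ = Unique-map-injective f (Permₛ.Unique-resp-↭ (setoid ℕ) (↭⇒↭ₛ c′↭ys) (colors-! c′))

  inj : ∀ x y → x ∈ usedColors c → y ∈ usedColors c → f x ≡ f y → x ≡ y
  inj x y i j = inj′ (∈-deduplicate⁺ ℕ._≟_ i) (∈-deduplicate⁺ ℕ._≟_ j)

  class-f : ∀ {x} → x ∈ colors c → class c x ≡ class c′ (f x)
  class-f = map-≡⇒≗ (colors c) (trans classes≡ (sym (map-∘ (colors c))))

  to : ∀ v {y} → y ∈ map f (c v) → y ∈ c′ v
  to v i with ∈-map⁻ f i
  ... | x , j , refl = ∈-class⁻ c′ (subst (λ S → lookup S v ≡ true) (class-f (∈-colors⁺ c j)) (∈-class⁺ c j))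

  from : ∀ v {y} → y ∈ c′ v → y ∈ map f (c v)
  from v i with ∈-map⁻ f (∈-resp-↭ c′↭ys (∈-colors⁺ c′ i))
  ... | x , j , refl = ∈-map⁺ f (∈-class⁻ c (subst (λ S → lookup S v ≡ true) (sym (class-f j)) (∈-class⁺ c′ i)))

-- Counting the colours at `v` by their classes turns the fold condition into a linear equation.
length-cell : ∀ {c : RawCol n} {L} → c ⊨ L → ∀ v → + length (c v) ≡ ∑ L (λ S → bit (lookup S v))
length-cell {c = c} {L} p v = begin
  + length (c v)                                  ≡⟨ trans (sym (ℤₚ.*-identityʳ _)) (sym (∑-const (c v) 1ℤ)) ⟩
  ∑ (c v) (λ _ → 1ℤ)                              ≡⟨ ∑-↭ (same-members⇒↭ (⊨-uniq p v) (Unique-filter⁺ at? (colors-! c)) to from) (λ _ → 1ℤ) ⟩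
  ∑ (filter at? (colors c)) (λ _ → 1ℤ)
    ≡⟨ ∑-cong (filter at? (colors c)) (λ i → cong bit (sym (proj₂ (∈-filter⁻ at? {xs = colors c} i)))) ⟩
  ∑ (filter at? (colors c)) (λ x → bit (lookup (class c x) v))
    ≡⟨ ∑-filter at? (colors c) _ (λ x ne → cong bit (off (lookup (class c x) v) ne)) ⟩
  ∑ (colors c) (λ x → bit (lookup (class c x) v))
    ≡⟨ ∑-classes p (λ S → bit (lookup S v)) (cong bit (Vecₚ.lookup-replicate v false)) ⟨
  ∑ L (λ S → bit (lookup S v))                    ∎
  where
  open ≡-Reasoning
  at? : ∀ x → Dec (lookup (class c x) v ≡ true)
  at? x = lookup (class c x) v Bool.≟ true

  off : ∀ b → b ≢ true → b ≡ false
  off true  ne = contradiction refl ne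
  off false ne = refl

  to : ∀ {x} → x ∈ c v → x ∈ filter at? (colors c)
  to i = ∈-filter⁺ at? (∈-colors⁺ c i) (∈-class⁺ c i)

  from : ∀ {x} → x ∈ filter at? (colors c) → x ∈ c v
  from i = ∈-class⁻ c (proj₂ (∈-filter⁻ at? {xs = colors c} i))

-- The helper behind dunion is private in Defs; unification with the unfolded dunion recovers it here.
mutual
  dunionFrom : ℕ → ℕ → List (RawCol n) → RawCol n
  dunionFrom = _

  dunion-unfold : ∀ (cs : List (RawCol n)) v → dunion cs v ≡ dunionFrom (length cs) 0 cs v
  dunion-unfold cs v with length cs
  ... | k with 0
  ... | i = refl

-- Classes of disjoint unions

residue : ∀ {k i} .{{_ : NonZero k}} x → i ℕ.< k → (k ℕ.* x ℕ.+ i) ℕ.% k ≡ i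
residue {k} {i} x i<k = trans (cong (ℕ._% k) (trans (ℕₚ.+-comm (k ℕ.* x) i) (cong (i ℕ.+_) (ℕₚ.*-comm k x))))
  (trans (ℕ.[m+kn]%n≡m%n i x k) (ℕ.m<n⇒m%n≡m i<k))

-- The residue of a colour modulo `k` names its summand. The last component carries this through the
-- induction: the tail uses residues above `i`, so its keys avoid those of the head.
⊨-dunionFrom : ∀ k i {cs : List (RawCol n)} {Ls} → Pointwise _⊨_ cs Ls → i ℕ.+ length cs ℕ.≤ k →
  ∃ λ X → Presents (dunionFrom k i cs) X × map proj₂ X ≡ concat Ls
        × (∀ {x S} → (x , S) ∈ X → ∃₂ λ y j → x ≡ k ℕ.* y ℕ.+ j × i ℕ.≤ j × j ℕ.< k)
⊨-dunionFrom k i [] _ = [] , record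
  { keys-! = [] ; uniq = λ _ → [] ; sound = λ () ; compl = λ () } , refl , λ ()
⊨-dunionFrom {n} k i {c ∷ cs} {_ ∷ Ls} ((X₁ , pres₁ , refl) ∷ ps) i+l≤k
  with ⊨-dunionFrom k (suc i) ps (subst (ℕ._≤ k) (ℕₚ.+-suc i (length cs)) i+l≤k)
... | X₂ , pres₂ , classes₂ , keys₂ = map shiftKey X₁ ++ X₂ , record
    { keys-! = subst Unique (sym (map-++ proj₁ (map shiftKey X₁) X₂)) (Unique-++⁺
                 (subst Unique (trans (sym (map-∘ X₁)) (map-∘ X₁)) (Unique-map⁺ shift-injective P₁.keys-!))
                 P₂.keys-! (λ (a , b) → apart (shifted (key-source a)) (∈-map⁻ proj₁ b)))
    ; uniq   = λ v → Unique-++⁺ (Unique-map⁺ shift-injective (P₁.uniq v)) (P₂.uniq v) (λ (a , b) →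
                 apart (cell-source a) (cell-entry b))
    ; sound  = sound
    ; compl  = compl
    } , trans (map-++ proj₂ (map shiftKey X₁) X₂) (cong₂ _++_ (sym (map-∘ X₁)) classes₂) , keys
  where
  module P₁ = Presents pres₁
  module P₂ = Presents pres₂

  i<k : i ℕ.< k
  i<k = ℕₚ.≤-trans (ℕₚ.≤-trans (ℕₚ.≤-reflexive (ℕₚ.+-comm 1 i)) (ℕₚ.+-monoʳ-≤ i (ℕ.s≤s ℕ.z≤n))) i+l≤k

  instance
    k≢0 : NonZero k
    k≢0 = ℕ.>-nonZero (ℕₚ.≤-<-trans ℕ.z≤n i<k)

  shiftKey : ℕ × Class n → ℕ × Class n
  shiftKey (x , S) = k ℕ.* x ℕ.+ i , S

  shift-injective : ∀ {x y} → k ℕ.* x ℕ.+ i ≡ k ℕ.* y ℕ.+ i → x ≡ y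
  shift-injective {x} {y} e = ℕₚ.*-cancelˡ-≡ x y k (ℕₚ.+-cancelʳ-≡ i _ _ e)

  Shifted : ℕ → Set
  Shifted z = ∃ λ x → z ≡ k ℕ.* x ℕ.+ i

  shifted : ∀ {z} → (∃ λ e → e ∈ map shiftKey X₁ × z ≡ proj₁ e) → Shifted z
  shifted (_ , e∈ , refl) with ∈-map⁻ shiftKey e∈
  ... | (x , _) , _ , refl = x , refl

  key-source : ∀ {z} → z ∈ map proj₁ (map shiftKey X₁) → ∃ λ e → e ∈ map shiftKey X₁ × z ≡ proj₁ e
  key-source = ∈-map⁻ proj₁

  apart : ∀ {z} → Shifted z → (∃ λ e → e ∈ X₂ × z ≡ proj₁ e) → ⊥
  apart (x , eq) (_ , e∈ , refl) with keys₂ e∈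
  ... | y , j , eq′ , i<j , j<k = ℕₚ.<⇒≢ i<j (trans (sym (residue x i<k))
      (trans (cong (ℕ._% k) (trans (sym eq) eq′)) (residue y j<k)))

  cell-source : ∀ {v z} → z ∈ map (λ x → k ℕ.* x ℕ.+ i) (c v) → Shifted z
  cell-source a with ∈-map⁻ _ a
  ... | x , _ , eq = x , eq

  cell-entry : ∀ {v z} → z ∈ dunionFrom k (suc i) cs v → ∃ λ e → e ∈ X₂ × z ≡ proj₁ e
  cell-entry b with P₂.sound b
  ... | S , e∈ , _ = _ , e∈ , refl

  sound : ∀ {v x} → x ∈ dunionFrom k i (c ∷ cs) v → ∃ λ S → (x , S) ∈ map shiftKey X₁ ++ X₂ × lookup S v ≡ true
  sound {v} a with ∈-++⁻ (map (λ x → k ℕ.* x ℕ.+ i) (c v)) a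
  ... | inj₂ b with P₂.sound b
  ...   | S , e∈ , e = S , ∈-++⁺ʳ _ e∈ , e
  sound a | inj₁ b with ∈-map⁻ _ b
  ...   | x , x∈ , refl with P₁.sound x∈
  ...     | S , e∈ , e = S , ∈-++⁺ˡ (∈-map⁺ shiftKey e∈) , e

  compl : ∀ {v x S} → (x , S) ∈ map shiftKey X₁ ++ X₂ → lookup S v ≡ true → x ∈ dunionFrom k i (c ∷ cs) v
  compl a e with ∈-++⁻ (map shiftKey X₁) a
  ... | inj₂ b = ∈-++⁺ʳ _ (P₂.compl b e)
  ... | inj₁ b with ∈-map⁻ shiftKey b
  ...   | _ , e∈ , refl = ∈-++⁺ˡ (∈-map⁺ _ (P₁.compl e∈ e))

  keys : ∀ {x S} → (x , S) ∈ map shiftKey X₁ ++ X₂ → ∃₂ λ y j → x ≡ k ℕ.* y ℕ.+ j × i ℕ.≤ j × j ℕ.< k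
  keys a with ∈-++⁻ (map shiftKey X₁) a
  ... | inj₁ b with ∈-map⁻ shiftKey b
  ...   | (y , _) , _ , refl = y , i , refl , ℕₚ.≤-refl , i<k
  keys a | inj₂ b with keys₂ b
  ...   | y , j , eq , i<j , j<k = y , j , eq , ℕₚ.<⇒≤ i<j , j<k

⊨-resp : ∀ {c c′ : RawCol n} {L} → (∀ v → c v ≡ c′ v) → c ⊨ L → c′ ⊨ L
⊨-resp eq (X , pres , e) = X , record
  { keys-! = keys-!
  ; uniq   = λ v → subst Unique (eq v) (uniq v)
  ; sound  = λ {v} i → sound (subst (_ ∈_) (sym (eq v)) i)
  ; compl  = λ {v} i e → subst (_ ∈_) (eq v) (compl i e)
  } , e
  where open Presents pres

⊨-dunion : ∀ {cs : List (RawCol n)} {Ls} → Pointwise _⊨_ cs Ls → dunion cs ⊨ concat Ls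
⊨-dunion {cs = cs} ps with ⊨-dunionFrom (length cs) 0 ps ℕₚ.≤-refl
... | X , pres , e , _ = ⊨-resp (λ v → sym (dunion-unfold cs v)) (X , pres , e)

⊨-· : ∀ k {c : RawCol n} {L} → c ⊨ L → k · c ⊨ copies k L
⊨-· k {c} {L} p = ⊨-dunion (repeat k)
  where
  repeat : ∀ k → Pointwise _⊨_ (replicate k c) (replicate k L)
  repeat zero    = []
  repeat (suc k) = p ∷ repeat k

-- Restriction to a subgraph

_∣ᶜ_ : Class n → Graph n → Class n
S ∣ᶜ H = Vec.tabulate (λ v → lookup S v ∧ V H v)

lookup-∣ᶜ : ∀ (S : Class n) H v → lookup (S ∣ᶜ H) v ≡ lookup S v ∧ V H v
lookup-∣ᶜ S H v = Vecₚ.lookup∘tabulate _ v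

-- A class that becomes empty keeps its entry, so restriction preserves the number of listed
-- colours.
⊨-restrict : ∀ (H : Graph n) {c L} → c ⊨ L → restrict H c ⊨ map (_∣ᶜ H) L
⊨-restrict {n} H {c} (X , pres , refl) = map cut X , record
    { keys-! = subst Unique (map-∘ X) keys-!
    ; uniq   = uniq′
    ; sound  = sound′
    ; compl  = compl′
    } , trans (sym (map-∘ X)) (map-∘ X)
  where
  open Presents pres
  cut : ℕ × Class n → ℕ × Class n
  cut (x , S) = x , S ∣ᶜ H

  uniq′ : ∀ v → Unique (restrict H c v)
  uniq′ v with V H v
  ... | true  = uniq v
  ... | false = []

  sound′ : ∀ {v x} → x ∈ restrict H c v → ∃ λ S → (x , S) ∈ map cut X × lookup S v ≡ true
  sound′ {v} i with V H v in eq
  sound′ {v} i  | true with sound i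
  ... | S , j , e = S ∣ᶜ H , ∈-map⁺ cut j , trans (lookup-∣ᶜ S H v) (cong₂ _∧_ e eq)
  sound′ {v} () | false

  compl′ : ∀ {v x S} → (x , S) ∈ map cut X → lookup S v ≡ true → x ∈ restrict H c v
  compl′ {v} i e with ∈-map⁻ cut i
  ... | (x , S) , j , refl with trans (sym (lookup-∣ᶜ S H v)) e
  ... | e′ with lookup S v in eq | V H v
  ... | true | true = compl j eq

-- Colourings built from lists of classes

enumerate : ℕ → List A → List (ℕ × A)
enumerate i []       = []
enumerate i (x ∷ xs) = (i , x) ∷ enumerate (suc i) xs

enumerate-≥ : ∀ i (xs : List A) {e} → e ∈ enumerate i xs → i ℕ.≤ proj₁ e
enumerate-≥ i (x ∷ xs) (here refl) = ℕₚ.≤-refl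
enumerate-≥ i (x ∷ xs) (there k)   = ℕₚ.<⇒≤ (enumerate-≥ (suc i) xs k)

enumerate-! : ∀ i (xs : List A) → Unique (map proj₁ (enumerate i xs))
enumerate-! i []       = []
enumerate-! i (x ∷ xs) = Allₚ.map⁺ (All.tabulate (λ k → ℕₚ.<⇒≢ (enumerate-≥ (suc i) xs k))) ∷ enumerate-! (suc i) xs

enumerate-values : ∀ i (xs : List A) → map proj₂ (enumerate i xs) ≡ xs
enumerate-values i []       = refl
enumerate-values i (x ∷ xs) = cong (x ∷_) (enumerate-values (suc i) xs)

-- Positions in `L` serve as colours; an empty class reserves a number that no vertex carries.
realise : List (Class n) → RawCol n
realise L v = map proj₁ (filter (λ e → lookup (proj₂ e) v Bool.≟ true) (enumerate 0 L))

⊨-realise : ∀ (L : List (Class n)) → realise L ⊨ L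
⊨-realise {n} L = enumerate 0 L , record
    { keys-! = enumerate-! 0 L
    ; uniq   = λ v → AllPairsₚ.map⁺ (AllPairsₚ.filter⁺ (at? v) (AllPairsₚ.map⁻ (enumerate-! 0 L)))
    ; sound  = sound
    ; compl  = λ {v} i e → ∈-map⁺ proj₁ (∈-filter⁺ (at? v) i e)
    } , enumerate-values 0 L
  where
  at? : ∀ v (e : ℕ × Class n) → Dec (lookup (proj₂ e) v ≡ true)
  at? v e = lookup (proj₂ e) v Bool.≟ true

  sound : ∀ {v x} → x ∈ realise L v → ∃ λ S → (x , S) ∈ enumerate 0 L × lookup S v ≡ true
  sound {v} i with ∈-map⁻ proj₁ i
  ... | (_ , S) , j , refl with ∈-filter⁻ (at? v) {xs = enumerate 0 L} j
  ... | k , e = S , k , e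

-- Inequalities with cleared denominators

/-≤⁻ : ∀ i m .{{_ : NonZero m}} t → i ℚ./ m ℚ.≤ t → i * ↧ t ≤ ↥ t * + m
/-≤⁻ i (suc k) t@record{} le with ℚᵘₚ.≤-respˡ-≃ (ℚₚ.toℚᵘ-fromℚᵘ (mkℚᵘ i k)) (ℚₚ.toℚᵘ-mono-≤ le)
... | *≤* q = q

/-≤⁺ : ∀ i m .{{_ : NonZero m}} t → i * ↧ t ≤ ↥ t * + m → i ℚ./ m ℚ.≤ t
/-≤⁺ i (suc k) t@record{} q = ℚₚ.toℚᵘ-cancel-≤ (ℚᵘₚ.≤-respˡ-≃ (ℚᵘₚ.≃-sym (ℚₚ.toℚᵘ-fromℚᵘ (mkℚᵘ i k))) (*≤* q))

∑-mono : ∀ (xs : List A) {φ ψ : A → ℤ} → (∀ x → φ x ≤ ψ x) → ∑ xs φ ≤ ∑ xs ψ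
∑-mono []       le = ℤₚ.≤-refl
∑-mono (x ∷ xs) le = ℤₚ.+-mono-≤ (le x) (∑-mono xs le)

Admissible : Graph n → Class n → Set
Admissible G S = (∀ v → lookup S v ≡ true → V G v ≡ true)
               × (∀ u v → E G u v ≡ true → lookup S u ≡ true → lookup S v ≡ true → ⊥)

-- Palettes

module Palettes {n : ℕ} (t : ℚ) where

  P : ℕ
  P = ↧ₙ t

  instance
    P≢0 : NonZero P
    P≢0 = _

  -- Row zero asks for t · b colours in all (denominator cleared), row suc v for b colours at each vertex v.
  row : Fin (suc n) → Class n → ℤ
  row zero    S = + P
  row (suc v) S = bit (lookup S v)

  target : Graph n → Fin (suc n) → ℤ
  target G zero    = ↥ t
  target G (suc v) = bit (V G v)

  Palette : Graph n → ℕ → List (Class n) → Set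
  Palette G = Feasible (Admissible G) row (target G)

  Palette-fold : ∀ {G b b′ L} → b ≡ b′ → Palette G b L → Palette G b′ L
  Palette-fold refl pal = pal

  Palette-++ : ∀ {G b₁ L₁ b₂ L₂} → Palette G b₁ L₁ → Palette G b₂ L₂ → Palette G (b₁ ℕ.+ b₂) (L₁ ++ L₂)
  Palette-++ {G} {b₁} {L₁} {b₂} {L₂} p₁ p₂ = record
    { ok    = λ {S} i → admissible {S} (∈-++⁻ L₁ i)
    ; meets = λ r → trans (∑-++ L₁ L₂ (row r)) (trans (cong₂ _+_ (meets p₁ r) (meets p₂ r))
                (sym (ℤₚ.*-distribʳ-+ (target G r) (+ b₁) (+ b₂))))
    }
    where
    admissible : ∀ {S} → S ∈ L₁ ⊎ S ∈ L₂ → Admissible G S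
    admissible (inj₁ i) = ok p₁ i
    admissible (inj₂ i) = ok p₂ i

  Palette-[] : ∀ {G} → Palette G 0 []
  Palette-[] {G} = record { ok = λ () ; meets = λ r → sym (ℤₚ.*-zeroˡ (target G r)) }

  Palette-copies : ∀ k {G b L} → Palette G b L → Palette G (k ℕ.* b) (copies k L)
  Palette-copies zero    pal = Palette-[]
  Palette-copies (suc k) pal = Palette-++ pal (Palette-copies k pal)

  Palette-↭ : ∀ {G b L L′} → L ↭ L′ → Palette G b L → Palette G b L′
  Palette-↭ L↭L′ pal = record
    { ok    = λ i → ok pal (∈-resp-↭ (↭-sym L↭L′) i)
    ; meets = λ r → trans (sym (∑-↭ L↭L′ (row r))) (meets pal r)
    }

  -- The row for the total size makes the number of empty classes determined by the others.
  ∑-off-∅ : ∀ L L′ (i j : ℤ) → i * ∑ L (row zero) ≡ j * ∑ L′ (row zero) →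
            (∀ φ → φ ∅ ≡ 0ℤ → i * ∑ L φ ≡ j * ∑ L′ φ) → ∀ φ → i * ∑ L φ ≡ j * ∑ L′ φ
  ∑-off-∅ L L′ i j sizes off φ = begin
    i * ∑ L φ                                       ≡⟨ cong (i *_) (shifted L) ⟩
    i * (1ℤ * ∑ L φ′ + φ ∅ * ∑ L (λ _ → 1ℤ))        ≡⟨ expand i (∑ L φ′) (φ ∅) (∑ L (λ _ → 1ℤ)) ⟩
    i * ∑ L φ′ + φ ∅ * (i * ∑ L (λ _ → 1ℤ))         ≡⟨ cong₂ (λ x y → x + φ ∅ * y) (off φ′ (ℤₚ.+-inverseʳ (φ ∅))) lengths ⟩
    j * ∑ L′ φ′ + φ ∅ * (j * ∑ L′ (λ _ → 1ℤ))       ≡⟨ expand j (∑ L′ φ′) (φ ∅) (∑ L′ (λ _ → 1ℤ)) ⟨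
    j * (1ℤ * ∑ L′ φ′ + φ ∅ * ∑ L′ (λ _ → 1ℤ))      ≡⟨ cong (j *_) (shifted L′) ⟨
    j * ∑ L′ φ                                      ∎
    where
    open ≡-Reasoning
    -- Subtracting the constant `φ ∅` gives a function vanishing at `∅`; the constant contributes
    -- only through the length, which row zero measures.
    φ′ : Class n → ℤ
    φ′ S = φ S - φ ∅

    split : ∀ a b → a ≡ 1ℤ * (a - b) + b * 1ℤ
    split = solve-∀

    shifted : ∀ L → ∑ L φ ≡ 1ℤ * ∑ L φ′ + φ ∅ * ∑ L (λ _ → 1ℤ)
    shifted L = trans (∑-cong L (λ {S} _ → split (φ S) (φ ∅))) (∑-linear L 1ℤ (φ ∅) φ′ (λ _ → 1ℤ))

    expand : ∀ i s a l → i * (1ℤ * s + a * l) ≡ i * s + a * (i * l)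
    expand = solve-∀

    swap : ∀ p i l → p * (i * l) ≡ i * (p * l)
    swap = solve-∀

    scaled : ∀ i L → + P * (i * ∑ L (λ _ → 1ℤ)) ≡ i * ∑ L (row zero)
    scaled i L = trans (swap (+ P) i (∑ L (λ _ → 1ℤ))) (cong (i *_)
      (trans (sym (∑-scale L (+ P) (λ _ → 1ℤ))) (∑-cong L (λ _ → ℤₚ.*-identityʳ (+ P)))))

    lengths : i * ∑ L (λ _ → 1ℤ) ≡ j * ∑ L′ (λ _ → 1ℤ)
    lengths = ℤₚ.*-cancelˡ-≡ (+ P) _ _ (trans (scaled i L) (trans sizes (sym (scaled j L′))))

  classes : ∀ {G : Graph n} → MColoring G → List (Class n)
  classes f = map (class (col f)) (colors (col f))

  ⊨-col : ∀ {G} (f : MColoring G) → col f ⊨ classes f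
  ⊨-col f = ⊨-classes (col f) (IsColoring.uniq (valid f))

  -- `P` times the gap between t times the fold and the number of colours, hence the number of empty
  -- classes missing after taking `P` copies; `InFt t f` makes it nonnegative.
  slack : ∀ {G : Graph n} → MColoring G → ℤ
  slack f = ↥ t * + fold f - + numColors (col f) * + P

  -- The factor P is the denominator of t: it makes the total number of colours, t · P · fold f, an integer.
  padded : ∀ {G : Graph n} → MColoring G → List (Class n)
  padded f = copies P (classes f) ++ replicate ∣ slack f ∣ ∅

  ∑-padded : ∀ {G} (f : MColoring G) φ → ∑ (padded f) φ ≡ + P * ∑ (classes f) φ + + ∣ slack f ∣ * φ ∅
  ∑-padded f φ = trans (∑-++ (copies P (classes f)) _ φ)
    (cong₂ _+_ (∑-copies P (classes f) φ) (∑-replicate ∣ slack f ∣ ∅ φ))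

  ∑-padded-off-∅ : ∀ {G} (f : MColoring G) φ → φ ∅ ≡ 0ℤ → ∑ (padded f) φ ≡ + P * ∑ (classes f) φ
  ∑-padded-off-∅ f φ φ∅ = trans (∑-padded f φ) (trans (cong (λ z → + P * ∑ (classes f) φ + + ∣ slack f ∣ * z) φ∅)
    (drop (+ P * ∑ (classes f) φ) (+ ∣ slack f ∣)))
    where
    drop : ∀ a b → a + b * 0ℤ ≡ a
    drop = solve-∀

  padded-palette : ∀ {G} (f : MColoring G) → InFt t f → Palette G (P ℕ.* fold f) (padded f)
  padded-palette {G} f f≤t = record { ok = admissible ; meets = meets′ }
    where
    open ≡-Reasoning
    open IsColoring (valid f)

    admissible-class : ∀ x → Admissible G (class (col f) x)
    admissible-class x = inside , λ u v e a b → disj u v e x (∈-class⁻ (col f) a) (∈-class⁻ (col f) b)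
      where
      inside : ∀ v → lookup (class (col f) x) v ≡ true → V G v ≡ true
      inside v e = Boolₚ.¬-not λ eq → contradiction (subst (x ∈_) (outside v eq) (∈-class⁻ (col f) e)) λ ()

    admissible : ∀ {S} → S ∈ padded f → Admissible G S
    admissible i = from-part (∈-++⁻ (copies P (classes f)) i)
      where
      from-class : ∀ {S} → (∃ λ x → x ∈ colors (col f) × S ≡ class (col f) x) → Admissible G S
      from-class (x , _ , refl) = admissible-class x

      from-∅ : ∀ {S} → S ≡ ∅ → Admissible G S
      from-∅ refl = (λ v e → contradiction e (∉∅ v)) , λ u v _ e _ → ∉∅ u e

      from-part : ∀ {S} → S ∈ copies P (classes f) ⊎ S ∈ replicate ∣ slack f ∣ ∅ → Admissible G S
      from-part (inj₁ j) = from-class (∈-map⁻ (class (col f)) (∈-copies⁻ P j))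
      from-part (inj₂ j) = from-∅ (proj₁ (∈-replicate⁻ ∣ slack f ∣ j))

    slack≥0 : 0ℤ ≤ slack f
    slack≥0 = ℤₚ.i≤j⇒0≤j-i (/-≤⁻ (+ numColors (col f)) (fold f) {{fold≢0 f}} t f≤t)

    count : ∀ v → + length (col f v) ≡ + fold f * bit (V G v)
    count v with V G v in eq
    ... | true  = trans (cong +_ (size v eq)) (sym (ℤₚ.*-identityʳ (+ fold f)))
    ... | false = trans (cong (+_ ∘ length) (outside v eq)) (sym (ℤₚ.*-zeroʳ (+ fold f)))

    meets′ : ∀ r → ∑ (padded f) (row r) ≡ + (P ℕ.* fold f) * target G r
    meets′ zero = begin
      ∑ (padded f) (row zero)
        ≡⟨ ∑-padded f (row zero) ⟩
      + P * ∑ (classes f) (row zero) + + ∣ slack f ∣ * + P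
        ≡⟨ cong₂ (λ x y → + P * x + y * + P)
             (trans (∑-const (classes f) (+ P)) (cong (λ l → + l * + P) (length-map (class (col f)) (colors (col f)))))
             (ℤₚ.0≤i⇒+∣i∣≡i slack≥0) ⟩
      + P * (+ numColors (col f) * + P) + (↥ t * + fold f - + numColors (col f) * + P) * + P
        ≡⟨ collect (+ P) (+ numColors (col f)) (↥ t) (+ fold f) ⟩
      + P * + fold f * ↥ t
        ≡⟨ cong (_* ↥ t) (pos-* P (fold f)) ⟨
      + (P ℕ.* fold f) * ↥ t ∎
      where
      collect : ∀ p m q b → p * (m * p) + (q * b - m * p) * p ≡ p * b * q
      collect = solve-∀
    meets′ (suc v) = begin
      ∑ (padded f) (row (suc v))
        ≡⟨ ∑-padded-off-∅ f (row (suc v)) (cong bit (Vecₚ.lookup-replicate v false)) ⟩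
      + P * ∑ (classes f) (row (suc v))
        ≡⟨ cong (+ P *_) (trans (sym (length-cell (⊨-col f) v)) (count v)) ⟩
      + P * (+ fold f * bit (V G v))
        ≡⟨ trans (sym (ℤₚ.*-assoc (+ P) (+ fold f) (bit (V G v)))) (cong (_* bit (V G v)) (sym (pos-* P (fold f)))) ⟩
      + (P ℕ.* fold f) * bit (V G v) ∎

  realise-valid : ∀ {G b L} → Palette G b L → IsColoring G b (realise L)
  realise-valid {G} {b} {L} pal = record
    { uniq    = Presents.uniq pres
    ; size    = λ v e → ℤₚ.+-injective (trans (cell v) (trans (cong (λ z → + b * bit z) e) (ℤₚ.*-identityʳ (+ b))))
    ; outside = λ v e → empty (realise L v) (ℤₚ.+-injective (trans (cell v) (trans (cong (λ z → + b * bit z) e) (ℤₚ.*-zeroʳ (+ b)))))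
    ; disj    = disj
    }
    where
    pres = proj₁ (proj₂ (⊨-realise L))

    cell : ∀ v → + length (realise L v) ≡ + b * bit (V G v)
    cell v = trans (length-cell (⊨-realise L) v) (meets pal (suc v))

    empty : ∀ (xs : List ℕ) → length xs ≡ 0 → xs ≡ []
    empty [] _ = refl

    disj : ∀ u v → E G u v ≡ true → Disjoint (realise L u) (realise L v)
    disj u v e x i j with Presents.sound pres i | Presents.sound pres j
    -- A colour has one class, so a common colour would put both ends of an edge into a single
    -- independent set.
    ... | S , k , a | S′ , k′ , a′ with trans (Presents.entry-class pres k) (sym (Presents.entry-class pres k′))
    ... | refl = proj₂ (ok pal (subst (S ∈_) (enumerate-values 0 L) (∈-map⁺ proj₂ k))) u v e a a′

  realised : ∀ {G b L} → NonZero b → Palette G b L → MColoring G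
  realised {L = L} b≢0 pal = mcol _ {{b≢0}} (realise L) (realise-valid pal)

  -- Empty classes count in row zero but not in `numColors`, so the equation for the size becomes an
  -- upper bound.
  realised-InFt : ∀ {G b L} (b≢0 : NonZero b) (pal : Palette G b L) → InFt t (realised b≢0 pal)
  realised-InFt {G} {b} {L} b≢0 pal = /-≤⁺ (+ numColors c) b {{b≢0}} t (begin
    + numColors c * + P         ≡⟨ ∑-const (colors c) (+ P) ⟨
    ∑ (colors c) (λ _ → + P)    ≡⟨ ∑-used (⊨-realise L) (λ _ → + P) ⟨
    ∑ L (used (λ _ → + P))      ≤⟨ ∑-mono L (λ S → bounded (does (S ≟ᶜ ∅))) ⟩
    ∑ L (row zero)              ≡⟨ trans (meets pal zero) (ℤₚ.*-comm (+ b) (↥ t)) ⟩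
    ↥ t * + b                   ∎)
    where
    open ℤₚ.≤-Reasoning
    c = realise L
    bounded : ∀ z → (if z then 0ℤ else + P) ≤ + P
    bounded true  = +≤+ ℕ.z≤n
    bounded false = ℤₚ.≤-refl

  -- Each member is padded separately, which makes the whole a palette; away from `∅` it consists of
  -- `P` copies of `combined-classes`.
  combined : ∀ {G : Graph n} → List (WeightedCol G) → List (Class n)
  combined = concatMap (λ w → copies (proj₁ w) (padded (proj₂ w)))

  combined-palette : ∀ {G} (ws : List (WeightedCol G)) → All (λ w → NonZero (proj₁ w) × InFt t (proj₂ w)) ws →
                     Palette G (P ℕ.* combFold ws) (combined ws)
  combined-palette []             []               = Palette-fold (sym (ℕₚ.*-zeroʳ P)) Palette-[]
  combined-palette ((m , f) ∷ ws) ((_ , f≤t) ∷ as) =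
    Palette-fold distribute (Palette-++ (Palette-copies m (padded-palette f f≤t)) (combined-palette ws as))
    where
    open ≡-Reasoning
    distribute : m ℕ.* (P ℕ.* fold f) ℕ.+ P ℕ.* combFold ws ≡ P ℕ.* (m ℕ.* fold f ℕ.+ combFold ws)
    distribute = begin
      m ℕ.* (P ℕ.* fold f) ℕ.+ P ℕ.* combFold ws  ≡⟨ cong (ℕ._+ P ℕ.* combFold ws) (trans (sym (ℕₚ.*-assoc m P (fold f)))
                                                       (trans (cong (ℕ._* fold f) (ℕₚ.*-comm m P)) (ℕₚ.*-assoc P m (fold f)))) ⟩
      P ℕ.* (m ℕ.* fold f) ℕ.+ P ℕ.* combFold ws  ≡⟨ ℕₚ.*-distribˡ-+ P (m ℕ.* fold f) (combFold ws) ⟨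
      P ℕ.* (m ℕ.* fold f ℕ.+ combFold ws)        ∎

  combined-classes : ∀ {G : Graph n} → List (WeightedCol G) → List (Class n)
  combined-classes = concatMap (λ w → copies (proj₁ w) (classes (proj₂ w)))

  ⊨-combCol : ∀ {G} (ws : List (WeightedCol G)) → combCol ws ⊨ combined-classes ws
  ⊨-combCol {G} ws = ⊨-dunion (each ws)
    where
    each : ∀ (ws : List (WeightedCol G)) → Pointwise _⊨_ (map (λ w → proj₁ w · col (proj₂ w)) ws)
                                                         (map (λ w → copies (proj₁ w) (classes (proj₂ w))) ws)
    each []             = []
    each ((m , f) ∷ ws) = ⊨-· m (⊨-col f) ∷ each ws

  ∑-combined : ∀ {G} (ws : List (WeightedCol G)) φ → φ ∅ ≡ 0ℤ → ∑ (combined ws) φ ≡ + P * ∑ (combined-classes ws) φ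
  ∑-combined ws φ φ∅ = begin
    ∑ (combined ws) φ
      ≡⟨ ∑-concatMap _ ws φ ⟩
    ∑ ws (λ w → ∑ (copies (proj₁ w) (padded (proj₂ w))) φ)
      ≡⟨ ∑-cong ws (λ {w} _ → step (proj₁ w) (proj₂ w)) ⟩
    ∑ ws (λ w → + P * ∑ (copies (proj₁ w) (classes (proj₂ w))) φ)
      ≡⟨ ∑-scale ws (+ P) (λ w → ∑ (copies (proj₁ w) (classes (proj₂ w))) φ) ⟩
    + P * ∑ ws (λ w → ∑ (copies (proj₁ w) (classes (proj₂ w))) φ)
      ≡⟨ cong (+ P *_) (∑-concatMap (λ w → copies (proj₁ w) (classes (proj₂ w))) ws φ) ⟨
    + P * ∑ (combined-classes ws) φ ∎
    where
    open ≡-Reasoning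
    swap : ∀ m p s → m * (p * s) ≡ p * (m * s)
    swap = solve-∀
    step : ∀ m f → ∑ (copies m (padded f)) φ ≡ + P * ∑ (copies m (classes f)) φ
    step m f = trans (∑-copies m (padded f) φ) (trans (cong (+ m *_) (∑-padded-off-∅ f φ φ∅))
      (trans (swap (+ m) (+ P) (∑ (classes f) φ)) (cong (+ P *_) (sym (∑-copies m (classes f) φ)))))

zip-≡ : ∀ (g : A → B) xs ys → map g xs ≡ map g ys →
        ∃ λ (Z : List (A × A)) → map proj₁ Z ≡ xs × map proj₂ Z ≡ ys × (∀ {z} → z ∈ Z → g (proj₁ z) ≡ g (proj₂ z))
zip-≡ g []       []       e = [] , refl , refl , λ ()
zip-≡ g (x ∷ xs) (y ∷ ys) e with zip-≡ g xs ys (proj₂ (∷-injective e))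
... | Z , refl , refl , agree = (x , y) ∷ Z , refl , refl , λ { (here refl) → proj₁ (∷-injective e) ; (there i) → agree i }

-- Extremal colourings and their extensions

module Extremality {n : ℕ} (t : ℚ) (H : Graph n) where
  open Palettes {n} t
  open Multiplicity (_≟ᶜ_ {n})
  open Decomposition (_≟ᶜ_ {n}) (Admissible H) row (target H) zero (λ _ → +<+ ℕ.z<s) public

  -- In a combination equivalent to the colouring of `L`, every padded member is supported in `L`.
  -- Rigidity makes the first two proportional, hence equivalent, against their distinctness.
  rigid⇒extremal : ∀ {b L} (b≢0 : NonZero b) (pal : Palette H b L) → Rigid L → Extremal H t (realised b≢0 pal)
  rigid⇒extremal {b} {L} b≢0 pal rigid = realised-InFt b≢0 pal , not-combination
    where
    not-combination : ¬ IsCombination H t (realised b≢0 pal)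
    not-combination ([] , () , _)
    not-combination (_ ∷ [] , ℕ.s≤s () , _)
    not-combination (ws@((m₁ , f₁) ∷ (m₂ , f₂) ∷ ws′) , _ , as@((m₁≢0 , f₁≤t) ∷ (m₂≢0 , f₂≤t) ∷ _) ,
                     ((f₁≁f₂ ∷ _) ∷ _) , s , s≢0 , iso) =
      -- One factor `P` comes from the `P` copies in `padded`, the other from the fold
      -- `P ℕ.* fold f` of the padded palette.
      f₁≁f₂ (P ℕ.* P , ℕₚ.m*n≢0 P P ,
             ∑⇒Iso (⊨-· (P ℕ.* P ℕ.* fold f₂) (⊨-col f₁)) (⊨-· (P ℕ.* P ℕ.* fold f₁) (⊨-col f₂)) proportional)
      where
      open ≡-Reasoning
      F = combFold ws

      off-∅ : ∀ φ → φ ∅ ≡ 0ℤ → + (P ℕ.* (s ℕ.* F)) * ∑ L φ ≡ + (s ℕ.* b) * ∑ (combined ws) φ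
      off-∅ φ φ∅ = begin
        + (P ℕ.* (s ℕ.* F)) * ∑ L φ
          ≡⟨ trans (cong (_* ∑ L φ) (pos-* P (s ℕ.* F))) (ℤₚ.*-assoc (+ P) (+ (s ℕ.* F)) (∑ L φ)) ⟩
        + P * (+ (s ℕ.* F) * ∑ L φ)
          ≡⟨ cong (+ P *_) (trans (sym (∑-copies (s ℕ.* F) L φ)) (trans
               (Iso⇒∑ (⊨-· (s ℕ.* F) (⊨-realise L)) (⊨-· (s ℕ.* b) (⊨-combCol ws)) iso φ φ∅)
               (∑-copies (s ℕ.* b) (combined-classes ws) φ))) ⟩
        + P * (+ (s ℕ.* b) * ∑ (combined-classes ws) φ)
          ≡⟨ swap (+ P) (+ (s ℕ.* b)) (∑ (combined-classes ws) φ) ⟩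
        + (s ℕ.* b) * (+ P * ∑ (combined-classes ws) φ)
          ≡⟨ cong (+ (s ℕ.* b) *_) (∑-combined ws φ φ∅) ⟨
        + (s ℕ.* b) * ∑ (combined ws) φ ∎
        where
        swap : ∀ p m s → p * (m * s) ≡ m * (p * s)
        swap = solve-∀

      sizes : + (P ℕ.* (s ℕ.* F)) * ∑ L (row zero) ≡ + (s ℕ.* b) * ∑ (combined ws) (row zero)
      sizes = begin
        + (P ℕ.* (s ℕ.* F)) * ∑ L (row zero)
          ≡⟨ cong₂ _*_ (trans (pos-* P (s ℕ.* F)) (cong (+ P *_) (pos-* s F))) (meets pal zero) ⟩
        + P * (+ s * + F) * (+ b * ↥ t)
          ≡⟨ rearrange (+ P) (+ s) (+ F) (+ b) (↥ t) ⟩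
        + s * + b * (+ P * + F * ↥ t)
          ≡⟨ cong₂ _*_ (pos-* s b) (trans (meets (combined-palette ws as) zero) (cong (_* ↥ t) (pos-* P F))) ⟨
        + (s ℕ.* b) * ∑ (combined ws) (row zero) ∎
        where
        rearrange : ∀ p s f b q → p * (s * f) * (b * q) ≡ s * b * (p * f * q)
        rearrange = solve-∀

      -- Proportionality at the indicator of `S` compares multiplicities. `S` may be `∅`, so the
      -- isomorphism alone does not suffice and `sizes` enters through `∑-off-∅`.
      combined⊆L : ∀ {S} → S ∈ combined ws → S ∈ L
      combined⊆L {S} i = mult≢0⇒∈ (λ z → ℤₚ.<⇒≢
        (0<* {+ (s ℕ.* b)} (+<+ (ℕ.>-nonZero⁻¹ _ {{ℕₚ.m*n≢0 s b {{s≢0}} {{b≢0}}}})) (mult-pos i))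
        (sym (trans (sym (∑-off-∅ L (combined ws) (+ (P ℕ.* (s ℕ.* F))) (+ (s ℕ.* b)) sizes off-∅ (ind S)))
          (trans (cong (+ (P ℕ.* (s ℕ.* F)) *_) z) (ℤₚ.*-zeroʳ (+ (P ℕ.* (s ℕ.* F))))))))

      proportional : ∀ φ → φ ∅ ≡ 0ℤ → ∑ (copies (P ℕ.* P ℕ.* fold f₂) (classes f₁)) φ
                                    ≡ ∑ (copies (P ℕ.* P ℕ.* fold f₁) (classes f₂)) φ
      proportional φ φ∅ = begin
        ∑ (copies (P ℕ.* P ℕ.* fold f₂) (classes f₁)) φ  ≡⟨ scaled f₁ (fold f₂) ⟩
        + (P ℕ.* fold f₂) * ∑ (padded f₁) φ
          ≡⟨ rigid (padded-palette f₁ f₁≤t) (padded-palette f₂ f₂≤t)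
               (combined⊆L ∘ ∈-++⁺ˡ ∘ ∈-copies⁺ m₁ m₁≢0)
               (combined⊆L ∘ ∈-++⁺ʳ (copies m₁ (padded f₁)) ∘ ∈-++⁺ˡ ∘ ∈-copies⁺ m₂ m₂≢0) φ ⟩
        + (P ℕ.* fold f₁) * ∑ (padded f₂) φ              ≡⟨ scaled f₂ (fold f₁) ⟨
        ∑ (copies (P ℕ.* P ℕ.* fold f₁) (classes f₂)) φ  ∎
        where
        scaled : ∀ (f : MColoring H) b → ∑ (copies (P ℕ.* P ℕ.* b) (classes f)) φ ≡ + (P ℕ.* b) * ∑ (padded f) φ
        scaled f b = begin
          ∑ (copies (P ℕ.* P ℕ.* b) (classes f)) φ  ≡⟨ ∑-copies (P ℕ.* P ℕ.* b) (classes f) φ ⟩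
          + (P ℕ.* P ℕ.* b) * ∑ (classes f) φ
            ≡⟨ cong (_* ∑ (classes f) φ) (trans (pos-* (P ℕ.* P) b) (cong (_* + b) (pos-* P P))) ⟩
          + P * + P * + b * ∑ (classes f) φ         ≡⟨ rearrange (+ P) (+ b) (∑ (classes f) φ) ⟩
          + P * + b * (+ P * ∑ (classes f) φ)       ≡⟨ cong₂ _*_ (pos-* P b) (∑-padded-off-∅ f φ φ∅) ⟨
          + (P ℕ.* b) * ∑ (padded f) φ              ∎
          where
          rearrange : ∀ p b s → p * p * b * s ≡ p * b * (p * s)
          rearrange = solve-∀

  module _ (G : Graph n) (extensible : ∀ f → Extremal H t f → Extensible H G t f) where

    -- `M` restricts to `k` copies of `L` as a multiset. Here `φ ∅` is arbitrary, so empty classes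
    -- are matched too, as gluing demands.
    Extends : ℕ → List (Class n) → Set
    Extends b L = ∃₂ λ k M → NonZero k × Palette G (k ℕ.* b) M × (∀ φ → ∑ M (φ ∘ (_∣ᶜ H)) ≡ + k * ∑ L φ)

    extends-join : ∀ {b L b₁ L₁ b₂ L₂} (k k₁ k₂ : ℕ) → NonZero k → Extends b₁ L₁ → Extends b₂ L₂ →
                   k ℕ.* b ≡ k₁ ℕ.* b₁ ℕ.+ k₂ ℕ.* b₂ →
                   (∀ φ → + k * ∑ L φ ≡ + k₁ * ∑ L₁ φ + + k₂ * ∑ L₂ φ) → Extends b L
    extends-join {b} {L} {b₁} {L₁} {b₂} {L₂} k k₁ k₂ k≢0
                 (K₁ , M₁ , K₁≢0 , pal₁ , sum₁) (K₂ , M₂ , K₂≢0 , pal₂ , sum₂) folds sums =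
      -- `K₁` and `K₂` are the multiples of `L₁` and `L₂` already extended; the crossed factors
      -- bring both to `K₁ ℕ.* K₂`.
      K₁ ℕ.* K₂ ℕ.* k , copies (K₂ ℕ.* k₁) M₁ ++ copies (K₁ ℕ.* k₂) M₂ ,
      ℕₚ.m*n≢0 (K₁ ℕ.* K₂) k {{ℕₚ.m*n≢0 K₁ K₂ {{K₁≢0}} {{K₂≢0}}}} {{k≢0}} ,
      Palette-fold folds′ (Palette-++ (Palette-copies (K₂ ℕ.* k₁) pal₁) (Palette-copies (K₁ ℕ.* k₂) pal₂)) ,
      sums′
      where
      open ≡-Reasoning
      folds′ : K₂ ℕ.* k₁ ℕ.* (K₁ ℕ.* b₁) ℕ.+ K₁ ℕ.* k₂ ℕ.* (K₂ ℕ.* b₂) ≡ K₁ ℕ.* K₂ ℕ.* k ℕ.* b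
      folds′ = begin
        K₂ ℕ.* k₁ ℕ.* (K₁ ℕ.* b₁) ℕ.+ K₁ ℕ.* k₂ ℕ.* (K₂ ℕ.* b₂)  ≡⟨ collect K₁ K₂ k₁ k₂ b₁ b₂ ⟩
        K₁ ℕ.* K₂ ℕ.* (k₁ ℕ.* b₁ ℕ.+ k₂ ℕ.* b₂)                  ≡⟨ cong (K₁ ℕ.* K₂ ℕ.*_) folds ⟨
        K₁ ℕ.* K₂ ℕ.* (k ℕ.* b)                                  ≡⟨ ℕₚ.*-assoc (K₁ ℕ.* K₂) k b ⟨
        K₁ ℕ.* K₂ ℕ.* k ℕ.* b                                    ∎
        where
        collect : ∀ K₁ K₂ k₁ k₂ b₁ b₂ → K₂ ℕ.* k₁ ℕ.* (K₁ ℕ.* b₁) ℕ.+ K₁ ℕ.* k₂ ℕ.* (K₂ ℕ.* b₂)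
                                      ≡ K₁ ℕ.* K₂ ℕ.* (k₁ ℕ.* b₁ ℕ.+ k₂ ℕ.* b₂)
        collect = ℕ-solve-∀

      sums′ : ∀ φ → ∑ (copies (K₂ ℕ.* k₁) M₁ ++ copies (K₁ ℕ.* k₂) M₂) (φ ∘ (_∣ᶜ H)) ≡ + (K₁ ℕ.* K₂ ℕ.* k) * ∑ L φ
      sums′ φ = begin
        ∑ (copies (K₂ ℕ.* k₁) M₁ ++ copies (K₁ ℕ.* k₂) M₂) φ′
          ≡⟨ ∑-++ (copies (K₂ ℕ.* k₁) M₁) _ φ′ ⟩
        ∑ (copies (K₂ ℕ.* k₁) M₁) φ′ + ∑ (copies (K₁ ℕ.* k₂) M₂) φ′
          ≡⟨ cong₂ _+_ (part K₂ k₁ M₁ K₁ L₁ (sum₁ φ)) (part K₁ k₂ M₂ K₂ L₂ (sum₂ φ)) ⟩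
        + K₂ * + k₁ * (+ K₁ * ∑ L₁ φ) + + K₁ * + k₂ * (+ K₂ * ∑ L₂ φ)
          ≡⟨ collect (+ K₁) (+ K₂) (+ k₁) (+ k₂) (∑ L₁ φ) (∑ L₂ φ) ⟩
        + K₁ * + K₂ * (+ k₁ * ∑ L₁ φ + + k₂ * ∑ L₂ φ)
          ≡⟨ cong (+ K₁ * + K₂ *_) (sums φ) ⟨
        + K₁ * + K₂ * (+ k * ∑ L φ)
          ≡⟨ ℤₚ.*-assoc (+ K₁ * + K₂) (+ k) (∑ L φ) ⟨
        + K₁ * + K₂ * + k * ∑ L φ
          ≡⟨ cong (_* ∑ L φ) (trans (pos-* (K₁ ℕ.* K₂) k) (cong (_* + k) (pos-* K₁ K₂))) ⟨
        + (K₁ ℕ.* K₂ ℕ.* k) * ∑ L φ ∎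
        where
        φ′ : Class n → ℤ
        φ′ = φ ∘ (_∣ᶜ H)
        part : ∀ K k M K′ L → ∑ M φ′ ≡ + K′ * ∑ L φ → ∑ (copies (K ℕ.* k) M) φ′ ≡ + K * + k * (+ K′ * ∑ L φ)
        part K k M K′ L e = trans (∑-copies (K ℕ.* k) M φ′) (cong₂ _*_ (pos-* K k) e)
        collect : ∀ K₁ K₂ k₁ k₂ s₁ s₂ → K₂ * k₁ * (K₁ * s₁) + K₁ * k₂ * (K₂ * s₂) ≡ K₁ * K₂ * (k₁ * s₁ + k₂ * s₂)
        collect = solve-∀

    -- The realised colouring is extremal, so the hypothesis supplies an extension. Its equivalence
    -- fixes the nonempty restricted classes; the total size fixes the empty ones.
    extends-rigid : ∀ {b L} → NonZero b → Palette H b L → Rigid L → Extends b L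
    extends-rigid {b} {L} b≢0 pal rigid
      with extensible (realised b≢0 pal) (rigid⇒extremal b≢0 pal rigid)
    ... | f , f≤t , s , s≢0 , iso =
      k , copies (s ℕ.* b) (padded f) , ℕₚ.m*n≢0 s (P ℕ.* fold f) {{s≢0}} {{ℕₚ.m*n≢0 P (fold f) {{P≢0}} {{fold≢0 f}}}} ,
      Palette-fold folds (Palette-copies (s ℕ.* b) pal′) ,
      λ φ → trans (∑-copies (s ℕ.* b) (padded f) (φ ∘ (_∣ᶜ H)))
              (trans (cong (+ (s ℕ.* b) *_) (sym (∑-map (_∣ᶜ H) (padded f) φ)))
                     (∑-off-∅ (map (_∣ᶜ H) (padded f)) L (+ (s ℕ.* b)) (+ k) sizes off-∅ φ))
      where
      open ≡-Reasoning
      -- The equivalence compares `s ℕ.* b` copies of the restriction with `s ℕ.* fold f` copies of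
      -- `realise L`; padding adds the factor `P`.
      k = s ℕ.* (P ℕ.* fold f)
      pal′ = padded-palette f f≤t

      folds : s ℕ.* b ℕ.* (P ℕ.* fold f) ≡ k ℕ.* b
      folds = swap s b (P ℕ.* fold f)
        where
        swap : ∀ s b f → s ℕ.* b ℕ.* f ≡ s ℕ.* f ℕ.* b
        swap = ℕ-solve-∀

      sizes : + (s ℕ.* b) * ∑ (map (_∣ᶜ H) (padded f)) (row zero) ≡ + k * ∑ L (row zero)
      sizes = begin
        + (s ℕ.* b) * ∑ (map (_∣ᶜ H) (padded f)) (row zero)
          ≡⟨ cong₂ _*_ (pos-* s b) (trans (∑-map (_∣ᶜ H) (padded f) (row zero)) (meets pal′ zero)) ⟩
        + s * + b * (+ (P ℕ.* fold f) * ↥ t)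
          ≡⟨ rearrange (+ s) (+ b) (+ (P ℕ.* fold f)) (↥ t) ⟩
        + s * + (P ℕ.* fold f) * (+ b * ↥ t)
          ≡⟨ cong₂ _*_ (pos-* s (P ℕ.* fold f)) (meets pal zero) ⟨
        + k * ∑ L (row zero) ∎
        where
        rearrange : ∀ s b f q → s * b * (f * q) ≡ s * f * (b * q)
        rearrange = solve-∀

      ∅∣H : ∅ ∣ᶜ H ≡ ∅
      ∅∣H = class-ext (λ v e → contradiction (trans (sym (cong (_∧ V H v) (Vecₚ.lookup-replicate v false)))
              (trans (sym (lookup-∣ᶜ ∅ H v)) e)) λ ()) (λ v e → contradiction e (∉∅ v))

      off-∅ : ∀ φ → φ ∅ ≡ 0ℤ → + (s ℕ.* b) * ∑ (map (_∣ᶜ H) (padded f)) φ ≡ + k * ∑ L φ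
      off-∅ φ φ∅ = begin
        + (s ℕ.* b) * ∑ (map (_∣ᶜ H) (padded f)) φ
          ≡⟨ cong (+ (s ℕ.* b) *_) (trans (∑-map (_∣ᶜ H) (padded f) φ) (trans
               (∑-padded-off-∅ f (φ ∘ (_∣ᶜ H)) (trans (cong φ ∅∣H) φ∅))
               (cong (+ P *_) (sym (∑-map (_∣ᶜ H) (classes f) φ))))) ⟩
        + (s ℕ.* b) * (+ P * ∑ (map (_∣ᶜ H) (classes f)) φ)
          ≡⟨ swap (+ (s ℕ.* b)) (+ P) (∑ (map (_∣ᶜ H) (classes f)) φ) ⟩
        + P * (+ (s ℕ.* b) * ∑ (map (_∣ᶜ H) (classes f)) φ)
          ≡⟨ cong (+ P *_) (trans (sym (∑-copies (s ℕ.* b) (map (_∣ᶜ H) (classes f)) φ)) (trans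
               (Iso⇒∑ (⊨-· (s ℕ.* b) (⊨-restrict H (⊨-col f))) (⊨-· (s ℕ.* fold f) (⊨-realise L)) iso φ φ∅)
               (trans (∑-copies (s ℕ.* fold f) L φ) (cong (_* ∑ L φ) (pos-* s (fold f)))))) ⟩
        + P * (+ s * + fold f * ∑ L φ)
          ≡⟨ rearrange (+ P) (+ s) (+ fold f) (∑ L φ) ⟩
        + s * (+ P * + fold f) * ∑ L φ
          ≡⟨ cong (_* ∑ L φ) (trans (pos-* s (P ℕ.* fold f)) (cong (+ s *_) (pos-* P (fold f)))) ⟨
        + k * ∑ L φ ∎
        where
        swap : ∀ p m s → p * (m * s) ≡ m * (p * s)
        swap = solve-∀
        rearrange : ∀ p s f l → p * (s * f * l) ≡ s * (p * f) * l
        rearrange = solve-∀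

    extends : ∀ {b L} → NonZero b → Palette H b L → Extends b L
    extends = decompose Extends (λ {b} {L} {b₁} {L₁} {b₂} {L₂} → extends-join {b} {L} {b₁} {L₁} {b₂} {L₂}) extends-rigid

-- Gluing along the intersection

module Gluing {n : ℕ} (t : ℚ) (G G₁ G₂ : Graph n)
              (V-∨ : ∀ x → V G x ≡ V G₁ x ∨ V G₂ x)
              (E-∨ : ∀ x y → E G x y ≡ E G₁ x y ∨ E G₂ x y) where
  open Palettes {n} t

  H = G₁ ∩G G₂

  -- Restriction may empty a class but never drops it, so row zero is unchanged; the row of `v` is
  -- multiplied by `bit (V H v)`.
  restrict-palette : ∀ {b L} → Palette G₁ b L → Palette H b (map (_∣ᶜ H) L)
  restrict-palette {b} {L} pal = record { ok = admissible ; meets = meets′ }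
    where
    open ≡-Reasoning
    ∧-true : ∀ a {b} → a ∧ b ≡ true → a ≡ true × b ≡ true
    ∧-true true e = refl , e

    admissible : ∀ {S} → S ∈ map (_∣ᶜ H) L → Admissible H S
    admissible i with ∈-map⁻ (_∣ᶜ H) i
    ... | S , j , refl = (λ v e → proj₂ (split v e)) , λ u v e a b →
        proj₂ (ok pal j) u v (proj₁ (∧-true (E G₁ u v) e)) (proj₁ (split u a)) (proj₁ (split v b))
      where
      split : ∀ v → lookup (S ∣ᶜ H) v ≡ true → lookup S v ≡ true × V H v ≡ true
      split v e = ∧-true (lookup S v) (trans (sym (lookup-∣ᶜ S H v)) e)

    bit-∧ : ∀ a b → bit (a ∧ b) ≡ bit b * bit a
    bit-∧ true  true  = refl
    bit-∧ true  false = refl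
    bit-∧ false true  = refl
    bit-∧ false false = refl

    absorb : ∀ a b → bit (a ∧ b) * bit a ≡ bit (a ∧ b)
    absorb true  b = ℤₚ.*-identityʳ (bit b)
    absorb false b = refl

    meets′ : ∀ r → ∑ (map (_∣ᶜ H) L) (row r) ≡ + b * target H r
    meets′ zero    = trans (∑-map (_∣ᶜ H) L (row zero)) (meets pal zero)
    meets′ (suc v) = begin
      ∑ (map (_∣ᶜ H) L) (row (suc v))         ≡⟨ ∑-map (_∣ᶜ H) L (row (suc v)) ⟩
      ∑ L (λ S → bit (lookup (S ∣ᶜ H) v))
        ≡⟨ ∑-cong L (λ {S} _ → trans (cong bit (lookup-∣ᶜ S H v)) (bit-∧ (lookup S v) (V H v))) ⟩
      ∑ L (λ S → bit (V H v) * bit (lookup S v))  ≡⟨ ∑-scale L (bit (V H v)) (row (suc v)) ⟩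
      bit (V H v) * ∑ L (row (suc v))         ≡⟨ cong (bit (V H v) *_) (meets pal (suc v)) ⟩
      bit (V H v) * (+ b * bit (V G₁ v))      ≡⟨ swap (bit (V H v)) (+ b) (bit (V G₁ v)) ⟩
      + b * (bit (V H v) * bit (V G₁ v))      ≡⟨ cong (+ b *_) (absorb (V G₁ v) (V G₂ v)) ⟩
      + b * bit (V H v)                       ∎
      where
      swap : ∀ p m s → p * (m * s) ≡ m * (p * s)
      swap = solve-∀

  -- Paired classes agree on the common vertices, so their union traces the first class on `G₁` and
  -- the second on `G₂`. Every edge lies in one of these graphs, where independence is known, and
  -- every cell count is inherited from one side.
  glue : ∀ {b A M} → Palette G₁ b A → Palette G₂ b M → map (_∣ᶜ H) A ≡ map (_∣ᶜ H) M → ∃ λ L → Palette G b L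
  glue {b} {A} {M} pal₁ pal₂ e with zip-≡ (_∣ᶜ H) A M e
  ... | Z , refl , refl , agree = map join Z , record { ok = admissible ; meets = meets′ }
    where
    join : Class n × Class n → Class n
    join (S , S′) = Vec.zipWith _∨_ S S′

    module _ {S S′} (i : (S , S′) ∈ Z) where
      ok₁ : Admissible G₁ S
      ok₁ = ok pal₁ (∈-map⁺ proj₁ i)

      ok₂ : Admissible G₂ S′
      ok₂ = ok pal₂ (∈-map⁺ proj₂ i)

      absent : ∀ {a c : Bool} → (a ≡ true → c ≡ true) → c ≡ false → a ≡ false
      absent {false} _ _ = refl
      absent {true}  f e with () ← trans (sym (f refl)) e

      shared : ∀ v → V G₁ v ≡ true → V G₂ v ≡ true → lookup S v ≡ lookup S′ v
      shared v e₁ e₂ = begin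
        lookup S v                            ≡⟨ Boolₚ.∧-identityʳ (lookup S v) ⟨
        lookup S v ∧ true                     ≡⟨ cong (lookup S v ∧_) (cong₂ _∧_ e₁ e₂) ⟨
        lookup S v ∧ V H v                    ≡⟨ lookup-∣ᶜ S H v ⟨
        lookup (S ∣ᶜ H) v                     ≡⟨ cong (λ T → lookup T v) (agree i) ⟩
        lookup (S′ ∣ᶜ H) v                    ≡⟨ lookup-∣ᶜ S′ H v ⟩
        lookup S′ v ∧ V H v                   ≡⟨ cong (lookup S′ v ∧_) (cong₂ _∧_ e₁ e₂) ⟩
        lookup S′ v ∧ true                    ≡⟨ Boolₚ.∧-identityʳ (lookup S′ v) ⟩
        lookup S′ v                           ∎
        where open ≡-Reasoning

      join-V₁ : ∀ v → V G₁ v ≡ true → lookup (join (S , S′)) v ≡ lookup S v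
      join-V₁ v e₁ with V G₂ v in e₂
      ... | true  = trans (Vecₚ.lookup-zipWith _∨_ v S S′) (trans (cong (lookup S v ∨_) (sym (shared v e₁ e₂))) (Boolₚ.∨-idem _))
      ... | false = trans (Vecₚ.lookup-zipWith _∨_ v S S′) (trans (cong (lookup S v ∨_) (absent (proj₁ ok₂ v) e₂)) (Boolₚ.∨-identityʳ _))

      join-¬V₁ : ∀ v → V G₁ v ≡ false → lookup (join (S , S′)) v ≡ lookup S′ v
      join-¬V₁ v e₁ = trans (Vecₚ.lookup-zipWith _∨_ v S S′) (cong (_∨ lookup S′ v) (absent (proj₁ ok₁ v) e₁))

      join-V₂ : ∀ v → V G₂ v ≡ true → lookup (join (S , S′)) v ≡ lookup S′ v
      join-V₂ v e₂ with V G₁ v in e₁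
      ... | true  = trans (join-V₁ v e₁) (shared v e₁ e₂)
      ... | false = join-¬V₁ v e₁

      ends : ∀ (K : Graph n) {u v} → E K u v ≡ true → V K u ≡ true × V K v ≡ true
      ends K {u} {v} e = E-V K u v e , E-V K v u (trans (E-sym K v u) e)

      admissible-join : Admissible G (join (S , S′))
      admissible-join = inside , independent
        where
        inside : ∀ v → lookup (join (S , S′)) v ≡ true → V G v ≡ true
        inside v e with V G₁ v in e₁
        ... | true  = trans (V-∨ v) (cong (_∨ V G₂ v) e₁)
        ... | false = trans (V-∨ v) (cong₂ _∨_ e₁ (proj₁ ok₂ v (trans (sym (join-¬V₁ v e₁)) e)))

        independent : ∀ u v → E G u v ≡ true → lookup (join (S , S′)) u ≡ true → lookup (join (S , S′)) v ≡ true → ⊥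
        independent u v e a c with E G₁ u v in e₁
        ... | true  = let (u∈ , v∈) = ends G₁ e₁ in
                      proj₂ ok₁ u v e₁ (trans (sym (join-V₁ u u∈)) a) (trans (sym (join-V₁ v v∈)) c)
        ... | false = let e₂ = trans (sym (trans (E-∨ u v) (cong (_∨ E G₂ u v) e₁))) e
                          (u∈ , v∈) = ends G₂ e₂ in
                      proj₂ ok₂ u v e₂ (trans (sym (join-V₂ u u∈)) a) (trans (sym (join-V₂ v v∈)) c)

    admissible : ∀ {T} → T ∈ map join Z → Admissible G T
    admissible i with ∈-map⁻ join i
    ... | z , j , refl = admissible-join j

    meets′ : ∀ r → ∑ (map join Z) (row r) ≡ + b * target G r
    meets′ zero    = trans (∑-map join Z (row zero)) (trans (sym (∑-map proj₁ Z (row zero))) (meets pal₁ zero))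
    meets′ (suc v) with V G₁ v in e₁ | meets pal₁ (suc v)
    ... | true  | m₁ = begin
      ∑ (map join Z) (row (suc v))         ≡⟨ ∑-map join Z (row (suc v)) ⟩
      ∑ Z (row (suc v) ∘ join)             ≡⟨ ∑-cong Z (λ i → cong bit (join-V₁ i v e₁)) ⟩
      ∑ Z (row (suc v) ∘ proj₁)            ≡⟨ ∑-map proj₁ Z (row (suc v)) ⟨
      ∑ (map proj₁ Z) (row (suc v))        ≡⟨ m₁ ⟩
      + b * 1ℤ                             ≡⟨ cong (λ z → + b * bit z) (trans (V-∨ v) (cong (_∨ V G₂ v) e₁)) ⟨
      + b * bit (V G v)                    ∎
      where open ≡-Reasoning
    ... | false | _  = begin
      ∑ (map join Z) (row (suc v))         ≡⟨ ∑-map join Z (row (suc v)) ⟩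
      ∑ Z (row (suc v) ∘ join)             ≡⟨ ∑-cong Z (λ i → cong bit (join-¬V₁ i v e₁)) ⟩
      ∑ Z (row (suc v) ∘ proj₂)            ≡⟨ ∑-map proj₂ Z (row (suc v)) ⟨
      ∑ (map proj₂ Z) (row (suc v))        ≡⟨ meets pal₂ (suc v) ⟩
      + b * bit (V G₂ v)                   ≡⟨ cong (λ z → + b * bit z) (trans (V-∨ v) (cong (_∨ V G₂ v) e₁)) ⟨
      + b * bit (V G v)                    ∎
      where open ≡-Reasoning

theorem3 : ∀ {n : ℕ} (G G₁ G₂ : Graph n) (t : ℚ)
    → G₁ ⊆G G → G₂ ⊆G G
    → (∀ x → V G x ≡ V G₁ x ∨ V G₂ x)
    → (∀ x y → E G x y ≡ E G₁ x y ∨ E G₂ x y)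
    → χf≤ G₁ t
    → (∀ (f : MColoring (G₁ ∩G G₂)) → Extremal (G₁ ∩G G₂) t f
    → Extensible (G₁ ∩G G₂) G₂ t f)
    → χf≤ G t
theorem3 G G₁ G₂ t _ _ V-∨ E-∨ (f₁ , f₁≤t) extensible = conclude (extends G₂ extensible b≢0 (restrict-palette pal₁))
  where
  open Palettes t
  open Gluing t G G₁ G₂ V-∨ E-∨
  open Extremality t H
  b = P ℕ.* fold f₁
  b≢0 = ℕₚ.m*n≢0 P (fold f₁) {{P≢0}} {{fold≢0 f₁}}
  pal₁ = padded-palette f₁ f₁≤t

  conclude : Extends G₂ extensible b (map (_∣ᶜ H) (padded f₁)) → χf≤ G t
  conclude (k , M , k≢0 , pal₂ , sums) with ↭-map-inv (_∣ᶜ H) M↭L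
    where
    L = copies k (padded f₁)
    M↭L : map (_∣ᶜ H) M ↭ map (_∣ᶜ H) L
    M↭L = Multiplicity.∑-≡⇒↭ _≟ᶜ_ λ φ → begin
      ∑ (map (_∣ᶜ H) M) φ                       ≡⟨ ∑-map (_∣ᶜ H) M φ ⟩
      ∑ M (φ ∘ (_∣ᶜ H))                         ≡⟨ sums φ ⟩
      + k * ∑ (map (_∣ᶜ H) (padded f₁)) φ       ≡⟨ cong (+ k *_) (∑-map (_∣ᶜ H) (padded f₁) φ) ⟩
      + k * ∑ (padded f₁) (φ ∘ (_∣ᶜ H))         ≡⟨ ∑-copies k (padded f₁) (φ ∘ (_∣ᶜ H)) ⟨
      ∑ L (φ ∘ (_∣ᶜ H))                         ≡⟨ ∑-map (_∣ᶜ H) L φ ⟨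
      ∑ (map (_∣ᶜ H) L) φ                       ∎
      where open ≡-Reasoning
  -- `M′` reorders `M` so that its restricted classes agree position by position with those of the
  -- copies of `padded f₁`; this order is the matching of colours.
  ... | M′ , same , M↭M′ = let (_ , pal) = glue (Palette-copies k pal₁) (Palette-↭ M↭M′ pal₂) same in
    realised (ℕₚ.m*n≢0 k b {{k≢0}} {{b≢0}}) pal , realised-InFt (ℕₚ.m*n≢0 k b {{k≢0}} {{b≢0}}) pal
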